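{- Let $\omega=e^{2\pi i/3}$ and let $$H=\begin{pmatrix}1&1&1&1&1&1\\1&\omega&\omega^2&1&\omega&\omega^2\\1&\omega^2&\omega&\omega&1&\omega^2\\1&1&1&-1&-1&-1\\1&\omega&\omega^2&-1&-\omega&-\omega^2\\1&\omega^2&\omega&-\omega&-1&-\omega^2\end{pmatrix}.$$ Let $P$ be the $6\times 6$ permutation matrix such that $PH$ is obtained from $H$ by exchanging the first two rows and fixing the remaining rows, and set $K=PH$. Let $h_0,\dots,h_5$ and $k_0,\dots,k_5$ be the columns of $H$ and $K$, respectively, and let $\Phi_{27}$ be the $6\times 6$ array of vectors with $(i,j)$ entry $\frac{1}{\sqrt6}(h_i\odot k_j)\in\mathbb{C}^6$, $0\le i,j\le5$. Then $\Phi_{27}$ is a quantum Latin square of order $6$ and its cardinality is $27$.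
   Context: For $x,y\in\mathbb{C}^n$, $x\odot y=(x_0y_0,\dots,x_{n-1}y_{n-1})^{\mathsf T}$ is the entrywise (Schur) product. A quantum Latin square of order $n$, denoted $\mathrm{QLS}(n)$, is an $n\times n$ array $(\phi_{ij})_{0\le i,j\le n-1}$ of unit vectors in $\mathbb{C}^n$ such that every row and every column forms an orthonormal basis of $\mathbb{C}^n$. Two unit vectors $u,v$ are phase equivalent, $u\sim v$, if $u=e^{i\alpha}v$ for some $\alpha\in\mathbb{R}$. The cardinality of a quantum Latin square is the number of distinct phase-equivalence classes among its $n^2$ entries. -}

module Defs where

open import Level using (Level; _⊔_) renaming (suc to lsuc)
open import Algebra.Apartness.Structures using (IsHeytingField)
open import Algebra.Bundles using (CommutativeRing)
open import Algebra.Bundles.Raw using (RawRing)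
open import Algebra.Core using (Op₁; Op₂)
import Algebra.Definitions.RawMonoid as RawMonoidOps
import Algebra.Definitions.RawSemiring as RawSemiringOps
import Algebra.Properties.Ring as RingProperties
open import Data.Bool.Base using (if_then_else_)
open import Data.Fin.Base using (Fin; zero; suc; toℕ)
open import Data.Fin.Permutation using (Permutation′; _⟨$⟩ʳ_; transpose)
open import Data.Fin.Properties using (_≟_)
open import Data.Nat.Base as ℕ using (ℕ; NonZero; _!)
open import Data.Nat.Properties using (_!≢0)
open import Data.Product.Base using (Σ; ∃-syntax; _×_; _,_; proj₁; proj₂)
open import Data.Sum.Base using (_⊎_; inj₁; inj₂)
open import Data.Vec.Functional using (Vector; []; _∷_)
open import Function.Base using (_∘_)
open import Function.Definitions using (Bijective)
open import Relation.Binary.Core using (Rel)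
open import Relation.Binary.PropositionalEquality.Core using (_≡_)
open import Relation.Binary.Structures using (IsStrictPartialOrder)
open import Relation.Nullary.Decidable.Core using (does)
open import Relation.Nullary.Negation.Core using (¬_)

-- The real numbers, axiomatised as a Cauchy complete Archimedean ordered
-- field. Classically this determines ℝ up to isomorphism. The order is not
-- assumed to be decidable: x # y means x < y or y < x, and the Heyting field
-- axioms provide cotransitivity, tightness (¬ x # y implies x ≈ y) and
-- inverses of the elements apart from 0#.
record RealNumbers c ℓ₁ ℓ₂ : Set (lsuc (c ⊔ ℓ₁ ⊔ ℓ₂)) where
  infix  8 -_
  infixl 7 _*_
  infixl 6 _+_
  infix  4 _≈_ _<_ _#_
  field
    Carrier : Set c
    _≈_     : Rel Carrier ℓ₁
    _<_     : Rel Carrier ℓ₂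
    _+_     : Op₂ Carrier
    _*_     : Op₂ Carrier
    -_      : Op₁ Carrier
    0#      : Carrier
    1#      : Carrier

  _#_ : Rel Carrier ℓ₂
  x # y = x < y ⊎ y < x

  field
    isHeytingField       : IsHeytingField _≈_ _#_ _+_ _*_ -_ 0# 1#
    isStrictPartialOrder : IsStrictPartialOrder _≈_ _<_
    +-monoˡ-<            : ∀ z {x y} → x < y → x + z < y + z
    *-positive           : ∀ {x y} → 0# < x → 0# < y → 0# < x * y

  open IsHeytingField isHeytingField public
    using (isCommutativeRing; #⇒invertible; invertible⇒#; tight; #-cotrans)

  commutativeRing : CommutativeRing c ℓ₁
  commutativeRing = record { isCommutativeRing = isCommutativeRing }

  open CommutativeRing commutativeRing public
    using (_-_; ring; rawRing; +-rawMonoid)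

  fromℕ : ℕ → Carrier
  fromℕ n = RawMonoidOps._×_ +-rawMonoid n 1#

  -- ∣ x - y ∣ < ε
  Within : Carrier → Carrier → Carrier → Set ℓ₂
  Within ε x y = (x < y + ε) × (y < x + ε)

  IsCauchy : (ℕ → Carrier) → Set (c ⊔ ℓ₂)
  IsCauchy s = ∀ ε → 0# < ε →
    ∃[ N ] (∀ m n → N ℕ.≤ m → N ℕ.≤ n → Within ε (s m) (s n))

  _ConvergesTo_ : (ℕ → Carrier) → Carrier → Set (c ⊔ ℓ₂)
  s ConvergesTo l = ∀ ε → 0# < ε → ∃[ N ] (∀ n → N ℕ.≤ n → Within ε (s n) l)

  field
    archimedean : ∀ x → ∃[ n ] x < fromℕ n
    complete    : ∀ s → IsCauchy s → ∃[ l ] s ConvergesTo l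

  -- #⇒invertible speaks of x - 0#, which is ≈ x.
  inverse : ∀ x → x # 0# → Carrier
  inverse x x#0 = proj₁ (#⇒invertible x#0)

  private
    module < = IsStrictPartialOrder isStrictPartialOrder
    open CommutativeRing commutativeRing
      using (refl; sym; trans; +-cong; +-identityˡ; +-identityʳ; -‿cong; -‿inverseʳ; *-identityˡ; *-identityʳ)
    open RingProperties ring using (-0#≈0#; -‿distribˡ-*; -‿involutive)

    1#0 : 1# # 0#
    1#0 = invertible⇒#
      (1# , trans (*-identityˡ _) 1-0≈1 , trans (*-identityʳ _) 1-0≈1)
      where
      1-0≈1 : 1# - 0# ≈ 1#
      1-0≈1 = trans (+-cong refl -0#≈0#) (+-identityʳ 1#)

    0<1 : 0# < 1#
    0<1 with 1#0
    ... | inj₂ p = p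
    ... | inj₁ 1<0 = <.<-respʳ-≈ [-1]²≈1 (*-positive 0<-1 0<-1)
      where
      0<-1 : 0# < - 1#
      0<-1 = <.<-respˡ-≈ (-‿inverseʳ 1#) (<.<-respʳ-≈ (+-identityˡ _) (+-monoˡ-< (- 1#) 1<0))
      [-1]²≈1 : (- 1#) * (- 1#) ≈ 1#
      [-1]²≈1 = trans (sym (-‿distribˡ-* 1# (- 1#)))
        (trans (-‿cong (*-identityˡ (- 1#))) (-‿involutive 1#))

    x<1+x : ∀ x → x < 1# + x
    x<1+x x = <.<-respˡ-≈ (+-identityˡ x) (+-monoˡ-< x 0<1)

  fromℕ-positive : ∀ n .{{_ : NonZero n}} → 0# < fromℕ n
  fromℕ-positive (ℕ.suc ℕ.zero)      = x<1+x 0#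
  fromℕ-positive (ℕ.suc n@(ℕ.suc _)) = <.trans (fromℕ-positive n) (x<1+x (fromℕ n))

  infixl 7 _/_
  _/_ : Carrier → (n : ℕ) .{{_ : NonZero n}} → Carrier
  x / n = x * inverse (fromℕ n) (inj₂ (fromℕ-positive n))

module Complex {c ℓ₁ ℓ₂ : Level} (R : RealNumbers c ℓ₁ ℓ₂) where

  module ℝ = RealNumbers R

  ℝ : Set c
  ℝ = ℝ.Carrier

  record ℂ : Set c where
    constructor _+i_
    field
      re im : ℝ
  open ℂ public

  ℂ-rawRing : RawRing c ℓ₁
  ℂ-rawRing = record
    { Carrier = ℂ
    ; _≈_     = λ z w → (re z ℝ.≈ re w) × (im z ℝ.≈ im w)
    ; _+_     = λ z w → (re z ℝ.+ re w) +i (im z ℝ.+ im w)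
    ; _*_     = λ z w → (re z ℝ.* re w ℝ.- im z ℝ.* im w) +i (re z ℝ.* im w ℝ.+ im z ℝ.* re w)
    ; -_      = λ z → (ℝ.- re z) +i (ℝ.- im z)
    ; 0#      = ℝ.0# +i ℝ.0#
    ; 1#      = ℝ.1# +i ℝ.0#
    }

  open RawRing ℂ-rawRing public using (_≈_; _+_; _*_; -_; 0#; 1#)
  open RawSemiringOps (RawRing.rawSemiring ℂ-rawRing) public using (sum; _^_)

  real : ℝ → ℂ
  real x = x +i ℝ.0#

  imaginary : ℝ → ℂ
  imaginary y = ℝ.0# +i y

  conj : ℂ → ℂ
  conj z = re z +i (ℝ.- im z)

  expPartialSum : ℂ → ℕ → ℂ
  expPartialSum z n = sum {n} λ k → real (ℝ._/_ ℝ.1# (toℕ k !) {{toℕ k !≢0}}) * z ^ toℕ k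

  -- w = e^z, as the sum of the exponential series
  HasExp : ℂ → ℂ → Set (c ⊔ ℓ₂)
  HasExp z w = ((re ∘ expPartialSum z) ℝ.ConvergesTo re w)
             × ((im ∘ expPartialSum z) ℝ.ConvergesTo im w)

  -- s = sin x, as the imaginary part of e^{ix}
  HasSin : ℝ → ℝ → Set (c ⊔ ℓ₁ ⊔ ℓ₂)
  HasSin x s = ∃[ w ] HasExp (imaginary x) w × im w ℝ.≈ s

  -- π is the smallest positive zero of sin
  record IsPi (π : ℝ) : Set (c ⊔ ℓ₁ ⊔ ℓ₂) where
    field
      positive : ℝ.0# ℝ.< π
      isZero   : HasSin π ℝ.0#
      smallest : ∀ x → ℝ.0# ℝ.< x → x ℝ.< π → ¬ HasSin x ℝ.0#

  ℂ^ : ℕ → Set c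
  ℂ^ n = Vector ℂ n

  infix 4 _≋_
  _≋_ : ∀ {n} → ℂ^ n → ℂ^ n → Set ℓ₁
  u ≋ v = ∀ m → u m ≈ v m

  infixr 7 _·_
  _·_ : ∀ {n} → ℂ → ℂ^ n → ℂ^ n
  (a · v) m = a * v m

  infixl 7 _⊙_
  _⊙_ : ∀ {n} → ℂ^ n → ℂ^ n → ℂ^ n
  (u ⊙ v) m = u m * v m

  ⟨_,_⟩ : ∀ {n} → ℂ^ n → ℂ^ n → ℂ
  ⟨ u , v ⟩ = sum λ m → conj (u m) * v m

  linearCombination : ∀ {k n} → Vector ℂ k → Vector (ℂ^ n) k → ℂ^ n
  linearCombination a v m = sum λ i → a i * v i m

  δ : ∀ {n} → Fin n → Fin n → ℂ
  δ i j = if does (i ≟ j) then 1# else 0#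

  IsUnit : ∀ {n} → ℂ^ n → Set ℓ₁
  IsUnit u = ⟨ u , u ⟩ ≈ 1#

  record IsOrthonormalBasis {k n} (v : Vector (ℂ^ n) k) : Set (c ⊔ ℓ₁) where
    field
      orthonormal         : ∀ i j → ⟨ v i , v j ⟩ ≈ δ i j
      linearlyIndependent : ∀ a → linearCombination a v ≋ (λ _ → 0#) → ∀ i → a i ≈ 0#
      spanning            : ∀ x → ∃[ a ] linearCombination a v ≋ x

  Array : ℕ → Set c
  Array n = Fin n → Fin n → ℂ^ n

  record IsQuantumLatinSquare {n} (φ : Array n) : Set (c ⊔ ℓ₁) where
    field
      unit    : ∀ i j → IsUnit (φ i j)
      rows    : ∀ i → IsOrthonormalBasis (λ j → φ i j)
      columns : ∀ j → IsOrthonormalBasis (λ i → φ i j)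

  infix 4 _∼_
  _∼_ : ∀ {n} → ℂ^ n → ℂ^ n → Set (c ⊔ ℓ₁ ⊔ ℓ₂)
  u ∼ v = ∃[ α ] ∃[ w ] HasExp (imaginary α) w × u ≋ w · v

  -- A bijection from Fin k onto the positions of the array modulo phase
  -- equivalence of the entries.
  HasCardinality : ∀ {n} → Array n → ℕ → Set (c ⊔ ℓ₁ ⊔ ℓ₂)
  HasCardinality {n} φ k = Σ (Fin k → Fin n × Fin n) (Bijective _≡_ _∼ₚ_)
    where
    _∼ₚ_ : Rel (Fin n × Fin n) (c ⊔ ℓ₁ ⊔ ℓ₂)
    (i , j) ∼ₚ (i′ , j′) = φ i j ∼ φ i′ j′

  Matrix : ℕ → Set c
  Matrix n = Vector (Vector ℂ n) n

  infixl 7 _⊗_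
  _⊗_ : ∀ {n} → Matrix n → Matrix n → Matrix n
  (A ⊗ B) i j = sum λ k → A i k * B k j

  column : ∀ {n} → Matrix n → Fin n → ℂ^ n
  column A j i = A i j

  -- Row i of permutationMatrix σ ⊗ A is row σ(i) of A.
  permutationMatrix : ∀ {n} → Permutation′ n → Matrix n
  permutationMatrix σ i j = δ (σ ⟨$⟩ʳ i) j

  module _ (ω : ℂ) where

    private
      ω² : ℂ
      ω² = ω * ω

    H : Matrix 6
    H = (1# ∷ 1#   ∷ 1#   ∷ 1#    ∷ 1#    ∷ 1#     ∷ [])
      ∷ (1# ∷ ω    ∷ ω²   ∷ 1#    ∷ ω     ∷ ω²     ∷ [])
      ∷ (1# ∷ ω²   ∷ ω    ∷ ω     ∷ 1#    ∷ ω²     ∷ [])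
      ∷ (1# ∷ 1#   ∷ 1#   ∷ - 1#  ∷ - 1#  ∷ - 1#   ∷ [])
      ∷ (1# ∷ ω    ∷ ω²   ∷ - 1#  ∷ - ω   ∷ - ω²   ∷ [])
      ∷ (1# ∷ ω²   ∷ ω    ∷ - ω   ∷ - 1#  ∷ - ω²   ∷ [])
      ∷ []

    P : Matrix 6
    P = permutationMatrix (transpose zero (suc zero))

    K : Matrix 6
    K = P ⊗ H

    Φ₂₇ : (√6 : ℝ) → ℝ.0# ℝ.< √6 → Array 6
    Φ₂₇ √6 0<√6 i j = real (ℝ.inverse √6 (inj₂ 0<√6)) · (column H i ⊙ column K j)

{-# OPTIONS --safe #-}

-- The analytic input is 1 + ω + ω² = 0 together with conj ω = ω². The number
-- exp(πi) is real of modulus 1, so ω³ = exp(2πi) = exp(πi)² = 1, while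
-- ω conj ω = exp 0 = 1 gives conj ω = ω². Comparing imaginary parts in the
-- latter, im ω (1 + 2 re ω) = 0, and im ω ≠ 0 because π is the smallest positive
-- zero of the sine. All this rests on exp(z + w) = exp z exp w: the Cauchy
-- product of the two series is the series of the sum, and the difference
-- between the product of the n-th partial sums and the n-th partial sum of the
-- Cauchy product is O(2⁻ⁿ), by a recursion in n.
--
-- The entries of √6 Φ₂₇ then lie in ℤ[ω], where orthonormality of the rows and
-- columns, and their completeness, are finite computations. Two entries of Φ₂₇
-- are either equal, so that phase 0 identifies them, or have a 2 × 2 minor of
-- nonzero norm; in each case this is again decided by computation in ℤ[ω].
module Submission where

open import Defs
open import Algebra.Bundles using (CommutativeRing)
open import Algebra.Bundles.Raw using (RawRing)
import Algebra.Definitions.RawMonoid as RawMonoidOps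
import Algebra.Properties.CommutativeSemigroup as CommutativeSemigroupProperties
import Algebra.Properties.Ring as RingProperties
import Algebra.Properties.Semiring.Mult as Mult
import Algebra.Properties.Semiring.Mult.TCOptimised as Multiples
import Algebra.Properties.Semiring.Sum as Sum
import Algebra.Solver.Ring
open import Algebra.Solver.Ring.AlmostCommutativeRing using (_-Raw-AlmostCommutative⟶_; fromCommutativeRing)
open import Algebra.Structures using (IsCommutativeRing)
open import Data.Bool.Base using (true; false; if_then_else_)
open import Data.Empty using (⊥-elim)
open import Data.Fin.Base using (Fin; zero; suc; toℕ; splitAt; remQuot; _↑ˡ_; _↑ʳ_)
open import Data.Fin.Permutation using (transpose; _⟨$⟩ʳ_)
open import Data.Fin.Properties using (_≟_; all?; any?)
open import Data.Integer.Base as ℤ using (ℤ; +_; -[1+_]; 0ℤ; 1ℤ)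
import Data.Integer.Properties as ℤ
import Data.Maybe.Base as Maybe
open import Data.Nat.Base as ℕ using (ℕ; zero; suc; NonZero; nonZero; _!)
open import Data.Nat.Properties as ℕ using (_!≢0)
open import Data.Product.Base using (∃-syntax; _×_; _,_; proj₁; proj₂; map)
open import Data.Sign.Base as Sign using (Sign)
open import Data.Sum.Base using (_⊎_; inj₁; inj₂; [_,_]′)
open import Data.Vec.Functional using (Vector; []; _∷_)
open import Function.Base using (_∘_; id)
open import Level using (0ℓ)
open import Relation.Binary.Definitions using (DecidableEquality; WeaklyDecidable)
open import Relation.Binary.PropositionalEquality.Core as ≡ using (_≡_; _≢_)
import Relation.Binary.Reasoning.Setoid as SetoidReasoning
open import Relation.Binary.Structures using (IsStrictPartialOrder)
open import Relation.Nullary.Decidable using (does; dec-true; dec⇒maybe; from-yes; map′; _×-dec_; _⊎-dec_; ¬?)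
open import Relation.Nullary.Negation.Core using (¬_)

-- The count 27 = 36 - 9 comes from the vector d = (1, 1, ω, -1, -1, -ω): for i < 3, column 3 + i of
-- `H` is the entrywise product of d and column i. Exchanging the first two rows fixes d, so `K` has
-- the same property, and h(3+i) ⊙ k(j) = d ⊙ h(i) ⊙ k(j) = h(i) ⊙ k(3+j). This identifies the lower
-- left 3 × 3 block with the upper right one, position by position. Orthogonality of a row reduces
-- to that of the columns of `K`, because the entries of `H` have modulus 1: the inner product of
-- h(i) ⊙ k(j) and h(i) ⊙ k(l) is that of k(j) and k(l). Columns are dealt with symmetrically. The
-- order on the reals is not decidable, and this shapes the analysis. A sign can be split on only
-- once a number is known to be apart from 0. Estimates are therefore certificates: a ring identity
-- turns a sum of products of positive terms into the difference that has to be positive. Vanishing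
-- of a limit is obtained from tightness, by refuting both signs. Bounds in ℂ are componentwise,
-- which avoids the modulus.

-- Ring solver with integer coefficients for an arbitrary commutative ring

module IntegerCoefficients {c ℓ} (CR : CommutativeRing c ℓ) where

  open CommutativeRing CR
  open RingProperties ring
  open Multiples semiring using (×1-homo-*; ×-homo-+; 1+×) renaming (_×_ to _×ᵣ_)
  open SetoidReasoning setoid

  -- Built on the optimised multiple, for which 1 × x is x by definition. Thus `con (+ 1)` and
  -- `con (+ 2)` denote `1#` and `1# + 1#` on the nose, whereas `ℝ.fromℕ` leaves a trailing `0#`.
  fromℤ : ℤ → Carrier
  fromℤ (+ n)    = n ×ᵣ 1#
  fromℤ -[1+ n ] = - (suc n ×ᵣ 1#)

  private
    fromℤ-reflexive : ∀ {i j} → i ≡ j → fromℤ i ≈ fromℤ j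
    fromℤ-reflexive ≡.refl = refl

    [x+y]-[x+z]≈y-z : ∀ x y z → (x + y) - (x + z) ≈ y - z
    [x+y]-[x+z]≈y-z x y z = begin
      (x + y) - (x + z)       ≈⟨ +-cong (+-comm x y) (sym (-‿+-comm x z)) ⟩
      (y + x) + (- x + - z)   ≈⟨ +-assoc y x _ ⟩
      y + (x + (- x + - z))   ≈⟨ +-congˡ (+-assoc x (- x) (- z)) ⟨
      y + ((x - x) - z)       ≈⟨ +-congˡ (+-congʳ (-‿inverseʳ x)) ⟩
      y + (0# - z)            ≈⟨ +-congˡ (+-identityˡ (- z)) ⟩
      y - z                   ∎

    fromℤ-⊖ : ∀ m n → fromℤ (m ℤ.⊖ n) ≈ m ×ᵣ 1# - n ×ᵣ 1#
    fromℤ-⊖ m zero = begin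
      m ×ᵣ 1#        ≈⟨ +-identityʳ _ ⟨
      m ×ᵣ 1# + 0#   ≈⟨ +-congˡ -0#≈0# ⟨
      m ×ᵣ 1# - 0#   ∎
    fromℤ-⊖ zero (suc n) = sym (+-identityˡ _)
    fromℤ-⊖ (suc m) (suc n) = begin
      fromℤ (suc m ℤ.⊖ suc n)           ≈⟨ fromℤ-reflexive (ℤ.[1+m]⊖[1+n]≡m⊖n m n) ⟩
      fromℤ (m ℤ.⊖ n)                   ≈⟨ fromℤ-⊖ m n ⟩
      m ×ᵣ 1# - n ×ᵣ 1#                   ≈⟨ [x+y]-[x+z]≈y-z 1# _ _ ⟨
      (1# + m ×ᵣ 1#) - (1# + n ×ᵣ 1#)     ≈⟨ +-cong (1+× m 1#) (-‿cong (1+× n 1#)) ⟨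
      suc m ×ᵣ 1# - suc n ×ᵣ 1#           ∎

    signed : Sign → Carrier → Carrier
    signed Sign.+ x = x
    signed Sign.- x = - x

    signed-cong : ∀ s {x y} → x ≈ y → signed s x ≈ signed s y
    signed-cong Sign.+ eq = eq
    signed-cong Sign.- eq = -‿cong eq

    signed-* : ∀ s t x y → signed (s Sign.* t) (x * y) ≈ signed s x * signed t y
    signed-* Sign.+ Sign.+ x y = refl
    signed-* Sign.+ Sign.- x y = -‿distribʳ-* x y
    signed-* Sign.- Sign.+ x y = -‿distribˡ-* x y
    signed-* Sign.- Sign.- x y = begin
      x * y           ≈⟨ -‿involutive (x * y) ⟨
      - (- (x * y))   ≈⟨ -‿cong (-‿distribʳ-* x y) ⟩
      - (x * - y)     ≈⟨ -‿distribˡ-* x (- y) ⟩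
      - x * - y       ∎

    fromℤ-◃ : ∀ s n → fromℤ (s ℤ.◃ n) ≈ signed s (n ×ᵣ 1#)
    fromℤ-◃ Sign.+ n       = fromℤ-reflexive (ℤ.+◃n≡+n n)
    fromℤ-◃ Sign.- zero    = sym -0#≈0#
    fromℤ-◃ Sign.- (suc n) = refl

    fromℤ-sign : ∀ i → signed (ℤ.sign i) (ℤ.∣ i ∣ ×ᵣ 1#) ≈ fromℤ i
    fromℤ-sign (+ n)    = refl
    fromℤ-sign -[1+ n ] = refl

  fromℤ-+ : ∀ i j → fromℤ (i ℤ.+ j) ≈ fromℤ i + fromℤ j
  fromℤ-+ (+ m)    (+ n)    = ×-homo-+ 1# m n
  fromℤ-+ (+ m)    -[1+ n ] = fromℤ-⊖ m (suc n)
  fromℤ-+ -[1+ m ] (+ n)    = trans (fromℤ-⊖ n (suc m)) (+-comm _ _)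
  fromℤ-+ -[1+ m ] -[1+ n ] = begin
    - (suc (suc (m ℕ.+ n)) ×ᵣ 1#)        ≈⟨ -‿cong (1+× (suc (m ℕ.+ n)) 1#) ⟩
    - (1# + suc (m ℕ.+ n) ×ᵣ 1#)         ≈⟨ -‿cong (+-congˡ (×-homo-+ 1# (suc m) n)) ⟩
    - (1# + (suc m ×ᵣ 1# + n ×ᵣ 1#))      ≈⟨ -‿cong (x∙yz≈y∙xz 1# _ _) ⟩
    - (suc m ×ᵣ 1# + (1# + n ×ᵣ 1#))      ≈⟨ -‿cong (+-congˡ (1+× n 1#)) ⟨
    - (suc m ×ᵣ 1# + suc n ×ᵣ 1#)         ≈⟨ -‿+-comm _ _ ⟨
    - (suc m ×ᵣ 1#) + - (suc n ×ᵣ 1#)     ∎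
    where open CommutativeSemigroupProperties +-commutativeSemigroup using (x∙yz≈y∙xz)

  fromℤ-* : ∀ i j → fromℤ (i ℤ.* j) ≈ fromℤ i * fromℤ j
  fromℤ-* i j = begin
    fromℤ (i ℤ.* j)
      ≈⟨ fromℤ-◃ (ℤ.sign i Sign.* ℤ.sign j) (ℤ.∣ i ∣ ℕ.* ℤ.∣ j ∣) ⟩
    signed (ℤ.sign i Sign.* ℤ.sign j) ((ℤ.∣ i ∣ ℕ.* ℤ.∣ j ∣) ×ᵣ 1#)
      ≈⟨ signed-cong (ℤ.sign i Sign.* ℤ.sign j) (×1-homo-* ℤ.∣ i ∣ ℤ.∣ j ∣) ⟩
    signed (ℤ.sign i Sign.* ℤ.sign j) (ℤ.∣ i ∣ ×ᵣ 1# * (ℤ.∣ j ∣ ×ᵣ 1#))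
      ≈⟨ signed-* (ℤ.sign i) (ℤ.sign j) _ _ ⟩
    signed (ℤ.sign i) (ℤ.∣ i ∣ ×ᵣ 1#) * signed (ℤ.sign j) (ℤ.∣ j ∣ ×ᵣ 1#)
      ≈⟨ *-cong (fromℤ-sign i) (fromℤ-sign j) ⟩
    fromℤ i * fromℤ j ∎

  fromℤ-neg : ∀ i → fromℤ (ℤ.- i) ≈ - fromℤ i
  fromℤ-neg (+ zero)  = sym -0#≈0#
  fromℤ-neg (+ suc n) = refl
  fromℤ-neg -[1+ n ]  = sym (-‿involutive _)

  private
    morphism : ℤ.+-*-rawRing -Raw-AlmostCommutative⟶ fromCommutativeRing CR
    morphism = record
      { ⟦_⟧    = fromℤ
      ; +-homo = fromℤ-+
      ; *-homo = fromℤ-*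
      ; -‿homo = fromℤ-neg
      ; 0-homo = refl
      ; 1-homo = refl
      }

    _coeff≟_ : WeaklyDecidable (λ i j → fromℤ i ≈ fromℤ j)
    i coeff≟ j = Maybe.map fromℤ-reflexive (dec⇒maybe (i ℤ.≟ j))

  open Algebra.Solver.Ring ℤ.+-*-rawRing (fromCommutativeRing CR) morphism
    _coeff≟_
    public

-- Positivity, bounds and the null sequence ½ⁿ in the reals

module RealProperties {c ℓ₁ ℓ₂} (R : RealNumbers c ℓ₁ ℓ₂) where

  open RealNumbers R
  open CommutativeRing commutativeRing
    using ( setoid; refl; sym; trans; +-cong; +-congˡ; +-congʳ; *-congˡ; *-congʳ; -‿cong
          ; +-identityʳ; *-identityˡ; *-comm; -‿inverseʳ )
  open IntegerCoefficients commutativeRing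
  private module < = IsStrictPartialOrder isStrictPartialOrder
  open SetoidReasoning setoid

  Positive : Carrier → Set ℓ₂
  Positive x = 0# < x

  positive-resp : ∀ {x y} → x ≈ y → Positive x → Positive y
  positive-resp = <.<-respʳ-≈

  <⇒positive : ∀ {x y} → x < y → Positive (y - x)
  <⇒positive {x} {y} x<y = <.<-respˡ-≈ (-‿inverseʳ x) (+-monoˡ-< (- x) x<y)

  positive⇒< : ∀ {x y} → Positive (y - x) → x < y
  positive⇒< {x} {y} p = <.<-respˡ-≈ (solve 1 (λ x → con (+ 0) :+ x := x) refl x)
    (<.<-respʳ-≈ (solve 2 (λ x y → (y :- x) :+ x := y) refl x y) (+-monoˡ-< x p))

  infixl 6 _⊕_
  infixl 7 _⊛_

  _⊕_ : ∀ {x y} → Positive x → Positive y → Positive (x + y)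
  _⊕_ {x} {y} p q = <.trans q (<.<-respˡ-≈ (solve 1 (λ y → con (+ 0) :+ y := y) refl y) (+-monoˡ-< y p))

  _⊛_ : ∀ {x y} → Positive x → Positive y → Positive (x * y)
  _⊛_ = *-positive

  ¬positive-0 : ¬ Positive 0#
  ¬positive-0 = <.irrefl refl

  positive-asym : ∀ {x} → Positive x → ¬ Positive (- x)
  positive-asym {x} p q = ¬positive-0 (positive-resp (-‿inverseʳ x) (p ⊕ q))

  positive-1 : Positive 1#
  positive-1 = positive-resp (+-identityʳ 1#) (fromℕ-positive 1)

  2# : Carrier
  2# = 1# + 1#

  positive-2 : Positive 2#
  positive-2 = positive-1 ⊕ positive-1

  *-inverse : ∀ x (x#0 : x # 0#) → x * inverse x x#0 ≈ 1#
  *-inverse x x#0 = begin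
    x * inverse x x#0          ≈⟨ *-congʳ (solve 1 (λ x → x := x :- con (+ 0)) refl x) ⟩
    (x - 0#) * inverse x x#0   ≈⟨ proj₂ (proj₂ (#⇒invertible x#0)) ⟩
    1#                         ∎

  -- Invertibility yields only apartness from 0. The negative alternative is excluded by the product
  -- x (0 - y), which would be positive and equal to -1.
  positive-inverse : ∀ {x} (p : Positive x) → Positive (inverse x (inj₂ p))
  positive-inverse {x} p with invertible⇒# {inverse x (inj₂ p)} {0#} (x , xy≈1′ , trans (*-comm _ _) xy≈1′)
    where
    y = inverse x (inj₂ p)
    xy≈1′ : x * (y - 0#) ≈ 1#
    xy≈1′ = trans (*-congˡ (solve 1 (λ y → y :- con (+ 0) := y) refl y)) (*-inverse x (inj₂ p))
  ... | inj₂ q = q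
  ... | inj₁ y<0 = ⊥-elim (positive-asym positive-1 (positive-resp eq (p ⊛ <⇒positive y<0)))
    where
    y = inverse x (inj₂ p)
    eq : x * (0# - y) ≈ - 1#
    eq = trans (solve 2 (λ x y → x :* (con (+ 0) :- y) := :- (x :* y)) refl x y)
      (-‿cong (*-inverse x (inj₂ p)))

  positive-cancel : ∀ {k x} → Positive k → Positive (k * x) → Positive x
  positive-cancel {k} {x} p q = positive-resp eq (positive-inverse p ⊛ q)
    where
    k⁻¹ = inverse k (inj₂ p)
    eq : k⁻¹ * (k * x) ≈ x
    eq = trans (solve 3 (λ k⁻¹ k x → k⁻¹ :* (k :* x) := (k :* k⁻¹) :* x) refl k⁻¹ k x)
      (trans (*-congʳ (*-inverse k (inj₂ p))) (*-identityˡ x))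

  ¬positive⇒≈0 : ∀ {x} → ¬ Positive x → ¬ Positive (- x) → x ≈ 0#
  ¬positive⇒≈0 {x} p q = proj₁ (tight x 0#) λ where
    (inj₁ x<0) → q (positive-resp (solve 1 (λ x → con (+ 0) :- x := :- x) refl x) (<⇒positive x<0))
    (inj₂ 0<x) → p 0<x

  -- ∣ x ∣ < B
  Box : Carrier → Carrier → Set ℓ₂
  Box B x = Positive (B - x) × Positive (B + x)

  box-resp : ∀ {B x B′ x′} → B ≈ B′ → x ≈ x′ → Box B x → Box B′ x′
  box-resp B≈ x≈ (p , q) =
    positive-resp (+-cong B≈ (-‿cong x≈)) p , positive-resp (+-cong B≈ x≈) q

  -- The sum of the two conditions is 2B > 0, so the positivity of a bound never has to be carried
  -- along.
  box-bound : ∀ {B x} → Box B x → Positive B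
  box-bound {B} {x} (p , q) = positive-cancel positive-2
    (positive-resp (solve 2 (λ B x → (B :- x) :+ (B :+ x) := con (+ 2) :* B) refl B x) (p ⊕ q))

  box-0 : ∀ {B} → Positive B → Box B 0#
  box-0 {B} p = positive-resp (solve 1 (λ B → B := B :- con (+ 0)) refl B) p
              , positive-resp (solve 1 (λ B → B := B :+ con (+ 0)) refl B) p

  box-+ : ∀ {B B′ x x′} → Box B x → Box B′ x′ → Box (B + B′) (x + x′)
  box-+ {B} {B′} {x} {x′} (p , q) (p′ , q′) =
    positive-resp (solve 4 (λ B B′ x x′ → (B :- x) :+ (B′ :- x′) := (B :+ B′) :- (x :+ x′)) refl B B′ x x′) (p ⊕ p′) ,
    positive-resp (solve 4 (λ B B′ x x′ → (B :+ x) :+ (B′ :+ x′) := (B :+ B′) :+ (x :+ x′)) refl B B′ x x′) (q ⊕ q′)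

  box-neg : ∀ {B x} → Box B x → Box B (- x)
  box-neg {B} {x} (p , q) = positive-resp (solve 2 (λ B x → B :+ x := B :- (:- x)) refl B x) q , p

  -- 2 (BB′ ∓ xx′) = (B - x) (B′ ± x′) + (B + x) (B′ ∓ x′)
  box-* : ∀ {B B′ x x′} → Box B x → Box B′ x′ → Box (B * B′) (x * x′)
  box-* {B} {B′} {x} {x′} (p , q) (p′ , q′) =
    positive-cancel positive-2 (positive-resp
      (solve 4 (λ B B′ x x′ → (B :- x) :* (B′ :+ x′) :+ (B :+ x) :* (B′ :- x′) := con (+ 2) :* (B :* B′ :- x :* x′)) refl B B′ x x′)
      (p ⊛ q′ ⊕ q ⊛ p′)) ,
    positive-cancel positive-2 (positive-resp
      (solve 4 (λ B B′ x x′ → (B :- x) :* (B′ :- x′) :+ (B :+ x) :* (B′ :+ x′) := con (+ 2) :* (B :* B′ :+ x :* x′)) refl B B′ x x′)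
      (p ⊛ p′ ⊕ q ⊛ q′))

  box-mono : ∀ {B B′ x} → Positive (B′ - B) → Box B x → Box B′ x
  box-mono {B} {B′} {x} r (p , q) =
    positive-resp (solve 3 (λ B B′ x → (B′ :- B) :+ (B :- x) := B′ :- x) refl B B′ x) (r ⊕ p) ,
    positive-resp (solve 3 (λ B B′ x → (B′ :- B) :+ (B :+ x) := B′ :+ x) refl B B′ x) (r ⊕ q)

  box-cancel : ∀ {k B x} → Positive k → Box (k * B) (k * x) → Box B x
  box-cancel {k} {B} {x} r (p , q) =
    positive-cancel r (positive-resp (solve 3 (λ k B x → k :* B :- k :* x := k :* (B :- x)) refl k B x) p) ,
    positive-cancel r (positive-resp (solve 3 (λ k B x → k :* B :+ k :* x := k :* (B :+ x)) refl k B x) q)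

  within⇒box : ∀ {ε x y} → Within ε x y → Box ε (x - y)
  within⇒box {ε} {x} {y} (p , q) =
    positive-resp (solve 3 (λ ε x y → y :+ ε :- x := ε :- (x :- y)) refl ε x y) (<⇒positive p) ,
    positive-resp (solve 3 (λ ε x y → x :+ ε :- y := ε :+ (x :- y)) refl ε x y) (<⇒positive q)

  box⇒within : ∀ {ε x y} → Box ε (x - y) → Within ε x y
  box⇒within {ε} {x} {y} (p , q) =
    positive⇒< (positive-resp (solve 3 (λ ε x y → ε :- (x :- y) := y :+ ε :- x) refl ε x y) p) ,
    positive⇒< (positive-resp (solve 3 (λ ε x y → ε :+ (x :- y) := x :+ ε :- y) refl ε x y) q)

  -- A positive `x` is tested against ε = x, a negative one against ε = - x.
  box⇒≈0 : ∀ {x} → (∀ ε → Positive ε → Box ε x) → x ≈ 0#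
  box⇒≈0 {x} h = ¬positive⇒≈0
    (λ p → ¬positive-0 (positive-resp (-‿inverseʳ x) (proj₁ (h x p))))
    (λ p → ¬positive-0 (positive-resp (solve 1 (λ x → :- x :+ x := con (+ 0)) refl x) (proj₂ (h (- x) p))))

  below-fromℕ-mono : ∀ {x m n} → m ℕ.≤ n → x < fromℕ m → x < fromℕ n
  below-fromℕ-mono {x} m≤n = go (ℕ.≤⇒≤′ m≤n)
    where
    go : ∀ {m n} → m ℕ.≤′ n → x < fromℕ m → x < fromℕ n
    go (ℕ.≤′-reflexive ≡.refl) p = p
    go (ℕ.≤′-step {n = n} m≤n)   p = <.trans (go m≤n p)
      (positive⇒< (positive-resp (solve 1 (λ x → con (+ 1) := (con (+ 1) :+ x) :- x) refl (fromℕ n)) positive-1))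

  abstract
    ∃-box : ∀ x → ∃[ B ] Box B x
    ∃-box x with archimedean x | archimedean (- x)
    ... | m , x<m | n , -x<n = fromℕ (m ℕ.⊔ n) ,
      <⇒positive (below-fromℕ-mono (ℕ.m≤m⊔n m n) x<m) ,
      positive-resp (solve 2 (λ x y → y :- (:- x) := y :+ x) refl x (fromℕ (m ℕ.⊔ n)))
        (<⇒positive (below-fromℕ-mono (ℕ.m≤n⊔m m n) -x<n))

  pow : Carrier → ℕ → Carrier
  pow x zero    = 1#
  pow x (suc n) = x * pow x n

  positive-pow : ∀ {x} → Positive x → ∀ n → Positive (pow x n)
  positive-pow p zero    = positive-1
  positive-pow p (suc n) = p ⊛ positive-pow p n

  -- abstract, lest the positivity proof inside the inverse gets unfolded
  abstract
    ½ : Carrier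
    ½ = inverse 2# (inj₂ positive-2)

    positive-½ : Positive ½
    positive-½ = positive-inverse positive-2

    ½+½≈1 : ½ + ½ ≈ 1#
    ½+½≈1 = trans (solve 1 (λ h → h :+ h := con (+ 2) :* h) refl ½) (*-inverse 2# (inj₂ positive-2))

  -- A Bernoulli estimate: 2ⁿ grows at least linearly, so that the Archimedean axiom can force ½ⁿ to
  -- 0. The second component is carried along because 2 - (2 + n) ½ⁿ⁺¹ is the mean of the two
  -- components at n.
  [1+n]½ⁿ<2 : ∀ n → Positive (2# - (1# + fromℕ n) * pow ½ n) × Positive (2# - pow ½ n)
  [1+n]½ⁿ<2 zero =
    positive-resp (solve 0 (con (+ 1) := con (+ 2) :- (con (+ 1) :+ con (+ 0)) :* con (+ 1)) refl) positive-1 ,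
    positive-resp (solve 0 (con (+ 1) := con (+ 2) :- con (+ 1)) refl) positive-1
  [1+n]½ⁿ<2 (suc n) with [1+n]½ⁿ<2 n
  ... | p , q = positive-resp (sym first) (positive-½ ⊛ (p ⊕ q)) , positive-resp (sym second) (positive-½ ⊛ (positive-2 ⊕ q))
    where
    N = fromℕ n
    s = pow ½ n
    -- The solver treats ½ as an indeterminate. Writing the leading 2 in halves makes both
    -- identities below homogeneous of degree 1 in ½, hence valid as polynomial identities.
    2≈ : 2# ≈ (½ + ½) + (½ + ½)
    2≈ = sym (+-cong ½+½≈1 ½+½≈1)
    first : 2# - (1# + (1# + N)) * (½ * s) ≈ ½ * ((2# - (1# + N) * s) + (2# - s))
    first = trans (+-congʳ 2≈) (solve 3 (λ h N s → ((h :+ h) :+ (h :+ h)) :- (con (+ 1) :+ (con (+ 1) :+ N)) :* (h :* s)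
      := h :* ((con (+ 2) :- (con (+ 1) :+ N) :* s) :+ (con (+ 2) :- s))) refl ½ N s)
    second : 2# - ½ * s ≈ ½ * (2# + (2# - s))
    second = trans (+-congʳ 2≈) (solve 2 (λ h s → ((h :+ h) :+ (h :+ h)) :- h :* s := h :* (con (+ 2) :+ (con (+ 2) :- s))) refl ½ s)

  -- For n > 2/ε one has nε > 2 > (1 + n) ½ⁿ. The certificate writes n (ε - ½ⁿ) as the sum of ε (n -
  -- 2/ε), 2 - (1 + n) ½ⁿ and ½ⁿ.
  ½ⁿ-null : ∀ ε → Positive ε → ∃[ N ] (∀ n → N ℕ.≤ n → Positive (ε - pow ½ n))
  ½ⁿ-null ε ε>0 with archimedean (2# * inverse ε (inj₂ ε>0))
  ... | N , 2/ε<N = N , λ n N≤n →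
    let 2/ε<n = below-fromℕ-mono {n = n} N≤n 2/ε<N
        n>0 = <.trans (positive-2 ⊛ positive-inverse ε>0) 2/ε<n
    in positive-cancel n>0 (positive-resp (eq (fromℕ n) (pow ½ n))
         (ε>0 ⊛ <⇒positive 2/ε<n ⊕ proj₁ ([1+n]½ⁿ<2 n) ⊕ positive-pow positive-½ n))
    where
    ε⁻¹ = inverse ε (inj₂ ε>0)
    eq : ∀ n s → ε * (n - 2# * ε⁻¹) + (2# - (1# + n) * s) + s ≈ n * (ε - s)
    eq n s = begin
      ε * (n - 2# * ε⁻¹) + (2# - (1# + n) * s) + s
        ≈⟨ solve 4 (λ ε ε⁻¹ n s → ε :* (n :- con (+ 2) :* ε⁻¹) :+ (con (+ 2) :- (con (+ 1) :+ n) :* s) :+ s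
                       := n :* (ε :- s) :+ con (+ 2) :* (con (+ 1) :- ε :* ε⁻¹)) refl ε ε⁻¹ n s ⟩
      n * (ε - s) + 2# * (1# - ε * ε⁻¹)
        ≈⟨ +-congˡ (*-congˡ (+-congˡ (-‿cong (*-inverse ε (inj₂ ε>0))))) ⟩
      n * (ε - s) + 2# * (1# - 1#)
        ≈⟨ solve 1 (λ x → x :+ con (+ 2) :* (con (+ 1) :- con (+ 1)) := x) refl (n * (ε - s)) ⟩
      n * (ε - s) ∎

-- The ring of complex numbers, conjugation and componentwise bounds

module ComplexRing {c ℓ₁ ℓ₂} (R : RealNumbers c ℓ₁ ℓ₂) where

  open Complex R
  private
    module Rℝ = CommutativeRing ℝ.commutativeRing
    open IntegerCoefficients ℝ.commutativeRing

  ℂ-isCommutativeRing : IsCommutativeRing _≈_ _+_ _*_ -_ 0# 1#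
  ℂ-isCommutativeRing = record
    { isRing = record
      { +-isAbelianGroup = record
        { isGroup = record
          { isMonoid = record
            { isSemigroup = record
              { isMagma = record
                { isEquivalence = record
                  { refl  = Rℝ.refl , Rℝ.refl
                  ; sym   = λ (p , q) → Rℝ.sym p , Rℝ.sym q
                  ; trans = λ (p , q) (p′ , q′) → Rℝ.trans p p′ , Rℝ.trans q q′
                  }
                ; ∙-cong = λ (p , q) (p′ , q′) → Rℝ.+-cong p p′ , Rℝ.+-cong q q′
                }
              ; assoc = λ _ _ _ → Rℝ.+-assoc _ _ _ , Rℝ.+-assoc _ _ _
              }
            ; identity = (λ _ → Rℝ.+-identityˡ _ , Rℝ.+-identityˡ _)
                       , (λ _ → Rℝ.+-identityʳ _ , Rℝ.+-identityʳ _)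
            }
          ; inverse = (λ _ → Rℝ.-‿inverseˡ _ , Rℝ.-‿inverseˡ _)
                    , (λ _ → Rℝ.-‿inverseʳ _ , Rℝ.-‿inverseʳ _)
          ; ⁻¹-cong = λ (p , q) → Rℝ.-‿cong p , Rℝ.-‿cong q
          }
        ; comm = λ _ _ → Rℝ.+-comm _ _ , Rℝ.+-comm _ _
        }
      ; *-cong = λ (p , q) (p′ , q′) →
          Rℝ.+-cong (Rℝ.*-cong p p′) (Rℝ.-‿cong (Rℝ.*-cong q q′)) ,
          Rℝ.+-cong (Rℝ.*-cong p q′) (Rℝ.*-cong q p′)
      ; *-assoc = λ (a +i b) (c +i d) (e +i f) →
          solve 6 (λ a b c d e f → (a :* c :- b :* d) :* e :- (a :* d :+ b :* c) :* f
                                := a :* (c :* e :- d :* f) :- b :* (c :* f :+ d :* e)) Rℝ.refl a b c d e f ,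
          solve 6 (λ a b c d e f → (a :* c :- b :* d) :* f :+ (a :* d :+ b :* c) :* e
                                := a :* (c :* f :+ d :* e) :+ b :* (c :* e :- d :* f)) Rℝ.refl a b c d e f
      ; *-identity =
          (λ (a +i b) →
            solve 2 (λ a b → con (+ 1) :* a :- con (+ 0) :* b := a) Rℝ.refl a b ,
            solve 2 (λ a b → con (+ 1) :* b :+ con (+ 0) :* a := b) Rℝ.refl a b) ,
          (λ (a +i b) →
            solve 2 (λ a b → a :* con (+ 1) :- b :* con (+ 0) := a) Rℝ.refl a b ,
            solve 2 (λ a b → a :* con (+ 0) :+ b :* con (+ 1) := b) Rℝ.refl a b)
      ; distrib =
          (λ (a +i b) (c +i d) (e +i f) →
            solve 6 (λ a b c d e f → a :* (c :+ e) :- b :* (d :+ f) := (a :* c :- b :* d) :+ (a :* e :- b :* f)) Rℝ.refl a b c d e f ,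
            solve 6 (λ a b c d e f → a :* (d :+ f) :+ b :* (c :+ e) := (a :* d :+ b :* c) :+ (a :* f :+ b :* e)) Rℝ.refl a b c d e f) ,
          (λ (a +i b) (c +i d) (e +i f) →
            solve 6 (λ a b c d e f → (c :+ e) :* a :- (d :+ f) :* b := (c :* a :- d :* b) :+ (e :* a :- f :* b)) Rℝ.refl a b c d e f ,
            solve 6 (λ a b c d e f → (c :+ e) :* b :+ (d :+ f) :* a := (c :* b :+ d :* a) :+ (e :* b :+ f :* a)) Rℝ.refl a b c d e f)
      }
    ; *-comm = λ (a +i b) (c +i d) →
        solve 4 (λ a b c d → a :* c :- b :* d := c :* a :- d :* b) Rℝ.refl a b c d ,
        solve 4 (λ a b c d → a :* d :+ b :* c := c :* b :+ d :* a) Rℝ.refl a b c d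
    }

  ℂ-commutativeRing : CommutativeRing c ℓ₁
  ℂ-commutativeRing = record { isCommutativeRing = ℂ-isCommutativeRing }

  conj-cong : ∀ {z w} → z ≈ w → conj z ≈ conj w
  conj-cong (p , q) = p , Rℝ.-‿cong q

  conj-+ : ∀ z w → conj (z + w) ≈ conj z + conj w
  conj-+ (a +i b) (c +i d) = Rℝ.refl , solve 2 (λ b d → :- (b :+ d) := :- b :+ :- d) Rℝ.refl b d

  conj-neg : ∀ z → conj (- z) ≈ - conj z
  conj-neg z = Rℝ.refl , Rℝ.refl

  conj-* : ∀ z w → conj (z * w) ≈ conj z * conj w
  conj-* (a +i b) (c +i d) =
    solve 4 (λ a b c d → a :* c :- b :* d := a :* c :- (:- b) :* (:- d)) Rℝ.refl a b c d ,
    solve 4 (λ a b c d → :- (a :* d :+ b :* c) := a :* (:- d) :+ (:- b) :* c) Rℝ.refl a b c d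

  conj-real : ∀ x → conj (real x) ≈ real x
  conj-real x = Rℝ.refl , solve 0 (:- con (+ 0) := con (+ 0)) Rℝ.refl

  real-* : ∀ x y → real (x ℝ.* y) ≈ real x * real y
  real-* x y =
    solve 2 (λ x y → x :* y := x :* y :- con (+ 0) :* con (+ 0)) Rℝ.refl x y ,
    solve 2 (λ x y → con (+ 0) := x :* con (+ 0) :+ con (+ 0) :* y) Rℝ.refl x y

  real-*-re : ∀ x z → x ℝ.* re z ℝ.≈ re (real x * z)
  real-*-re x (a +i b) = solve 3 (λ x a b → x :* a := x :* a :- con (+ 0) :* b) Rℝ.refl x a b

  real-*-im : ∀ x z → x ℝ.* im z ℝ.≈ im (real x * z)
  real-*-im x (a +i b) = solve 3 (λ x a b → x :* b := x :* b :+ con (+ 0) :* a) Rℝ.refl x a b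

  open RealProperties R

  -- ∣ re z ∣ < B and ∣ im z ∣ < B
  BoxC : ℝ → ℂ → Set ℓ₂
  BoxC B z = Box B (re z) × Box B (im z)

  boxC-resp : ∀ {B z B′ z′} → B ℝ.≈ B′ → z ≈ z′ → BoxC B z → BoxC B′ z′
  boxC-resp B≈ (p≈ , q≈) (p , q) = box-resp B≈ p≈ p , box-resp B≈ q≈ q

  boxC-0 : ∀ {B} → Positive B → BoxC B 0#
  boxC-0 p = box-0 p , box-0 p

  boxC-+ : ∀ {B B′ z z′} → BoxC B z → BoxC B′ z′ → BoxC (B ℝ.+ B′) (z + z′)
  boxC-+ (p , q) (p′ , q′) = box-+ p p′ , box-+ q q′

  boxC-neg : ∀ {B z} → BoxC B z → BoxC B (- z)
  boxC-neg (p , q) = box-neg p , box-neg q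

  -- Each component of a product is a sum of two real products, hence 2BB′ in place of BB′.
  boxC-* : ∀ {B B′ z z′} → BoxC B z → BoxC B′ z′ → BoxC (B ℝ.* B′ ℝ.+ B ℝ.* B′) (z * z′)
  boxC-* (p , q) (p′ , q′) = box-+ (box-* p p′) (box-neg (box-* q q′)) , box-+ (box-* p q′) (box-* q p′)

  boxC-mono : ∀ {B B′ z} → Positive (B′ ℝ.- B) → BoxC B z → BoxC B′ z
  boxC-mono r (p , q) = box-mono r p , box-mono r q

  boxC-cancel : ∀ {k B z} → Positive k → BoxC (k ℝ.* B) (real k * z) → BoxC B z
  boxC-cancel {k} {B} {z} r (p , q) =
    box-cancel r (box-resp Rℝ.refl (Rℝ.sym (real-*-re k z)) p) ,
    box-cancel r (box-resp Rℝ.refl (Rℝ.sym (real-*-im k z)) q)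

  abstract
    ∃-boxC : ∀ z → ∃[ B ] BoxC B z
    ∃-boxC z with ∃-box (re z) | ∃-box (im z)
    -- The sum serves as a common bound: it exceeds each summand because the other one is positive
    -- by `box-bound`.
    ... | B , p | B′ , q = B ℝ.+ B′ ,
      box-mono (positive-resp (solve 2 (λ B B′ → B′ := (B :+ B′) :- B) Rℝ.refl B B′) (box-bound q)) p ,
      box-mono (positive-resp (solve 2 (λ B B′ → B := (B :+ B′) :- B′) Rℝ.refl B B′) (box-bound p)) q

-- Cauchy products and formal exponential series over a commutative ring

module Convolution {c ℓ} (CR : CommutativeRing c ℓ) where

  open CommutativeRing CR
  open IntegerCoefficients CR
  open Mult semiring using () renaming (_×_ to _×ᵣ_)
  open Sum semiring using (sum; sum-cong-≋; ∑-distrib-+; *-distribˡ-sum)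
  open SetoidReasoning setoid

  Seq : Set c
  Seq = ℕ → Carrier

  partialSum : Seq → ℕ → Carrier
  partialSum a n = sum {n} (a ∘ toℕ)

  partialSum-cong : ∀ {a b} → (∀ n → a n ≈ b n) → ∀ n → partialSum a n ≈ partialSum b n
  partialSum-cong a≈b n = sum-cong-≋ {n} (a≈b ∘ toℕ)

  partialSum-last : ∀ a n → partialSum a (suc n) ≈ partialSum a n + a n
  partialSum-last a zero    = solve 1 (λ x → x :+ con (+ 0) := con (+ 0) :+ x) refl (a 0)
  partialSum-last a (suc n) = trans (+-congˡ (partialSum-last (a ∘ suc) n)) (sym (+-assoc _ _ _))

  infixl 7 _⋆_
  -- The Cauchy product Σ aₖ bₙ₋ₖ. Peeling off k = 0 and shifting `a` avoids subtraction of indices.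
  _⋆_ : Seq → Seq → Seq
  (a ⋆ b) zero    = a 0 * b 0
  (a ⋆ b) (suc n) = a 0 * b (suc n) + ((a ∘ suc) ⋆ b) n

  ⋆-cong : ∀ {a a′ b b′} → (∀ n → a n ≈ a′ n) → (∀ n → b n ≈ b′ n) → ∀ n → (a ⋆ b) n ≈ (a′ ⋆ b′) n
  ⋆-cong p q zero    = *-cong (p 0) (q 0)
  ⋆-cong p q (suc n) = +-cong (*-cong (p 0) (q (suc n))) (⋆-cong (p ∘ suc) q n)

  ⋆-distribʳ : ∀ a a′ b n → ((λ k → a k + a′ k) ⋆ b) n ≈ (a ⋆ b) n + (a′ ⋆ b) n
  ⋆-distribʳ a a′ b zero    = distribʳ _ _ _
  ⋆-distribʳ a a′ b (suc n) = trans (+-congˡ (⋆-distribʳ (a ∘ suc) (a′ ∘ suc) b n))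
    (solve 5 (λ x x′ y u v → (x :+ x′) :* y :+ (u :+ v) := (x :* y :+ u) :+ (x′ :* y :+ v)) refl
      (a 0) (a′ 0) (b (suc n)) _ _)

  ⋆-scaleˡ : ∀ z a b n → ((λ k → z * a k) ⋆ b) n ≈ z * (a ⋆ b) n
  ⋆-scaleˡ z a b zero    = *-assoc _ _ _
  ⋆-scaleˡ z a b (suc n) = trans (+-congˡ (⋆-scaleˡ z (a ∘ suc) b n))
    (solve 4 (λ z x y u → z :* x :* y :+ z :* u := z :* (x :* y :+ u)) refl z (a 0) (b (suc n)) _)

  ⋆-scaleʳ : ∀ z a b n → (a ⋆ (λ k → z * b k)) n ≈ z * (a ⋆ b) n
  ⋆-scaleʳ z a b zero    = solve 3 (λ z x y → x :* (z :* y) := z :* (x :* y)) refl z (a 0) (b 0)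
  ⋆-scaleʳ z a b (suc n) = trans (+-congˡ (⋆-scaleʳ z (a ∘ suc) b n))
    (solve 4 (λ z x y u → x :* (z :* y) :+ z :* u := z :* (x :* y :+ u)) refl z (a 0) (b (suc n)) _)

  -- The mirror image of the defining recursion: it shifts the right factor, which is what exposes
  -- the recurrence of `b` in `⋆-isExpSeries`.
  ⋆-last : ∀ a b n → (a ⋆ b) (suc n) ≈ (a ⋆ (b ∘ suc)) n + a (suc n) * b 0
  ⋆-last a b zero    = refl
  ⋆-last a b (suc n) = trans (+-congˡ (⋆-last (a ∘ suc) b n)) (sym (+-assoc _ _ _))

  fromℕ : ℕ → Carrier
  fromℕ n = n ×ᵣ 1#

  -- The Euler operator x d/dx, acting on the coefficients of a generating series.
  θ : Seq → Seq
  θ a n = fromℕ n * a n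

  -- In each product aₖ bₙ₋ₖ the weight n splits as k + (n - k). In the induction, `θ a ∘ suc`
  -- exceeds `θ (a ∘ suc)` by `a ∘ suc`, which accounts for the extra term `u`.
  θ-leibniz : ∀ a b n → θ (a ⋆ b) n ≈ (θ a ⋆ b) n + (a ⋆ θ b) n
  θ-leibniz a b zero = solve 2 (λ x y → con (+ 0) :* (x :* y) := con (+ 0) :* x :* y :+ x :* (con (+ 0) :* y)) refl (a 0) (b 0)
  θ-leibniz a b (suc n) = begin
    (1# + N) * (x * y + u)
      ≈⟨ solve 4 (λ N x y u → (con (+ 1) :+ N) :* (x :* y :+ u) := x :* ((con (+ 1) :+ N) :* y) :+ u :+ N :* u) refl N x y u ⟩
    x * ((1# + N) * y) + u + N * u
      ≈⟨ +-congˡ (θ-leibniz (a ∘ suc) b n) ⟩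
    x * ((1# + N) * y) + u + (v + w)
      ≈⟨ solve 6 (λ N x y u v w → x :* ((con (+ 1) :+ N) :* y) :+ u :+ (v :+ w)
                    := (con (+ 0) :* x :* y :+ (u :+ v)) :+ (x :* ((con (+ 1) :+ N) :* y) :+ w)) refl N x y u v w ⟩
    (0# * x * y + (u + v)) + (x * ((1# + N) * y) + w)
      ≈⟨ +-congʳ (+-congˡ (⋆-distribʳ (a ∘ suc) (θ (a ∘ suc)) b n)) ⟨
    (0# * x * y + ((λ k → a (suc k) + fromℕ k * a (suc k)) ⋆ b) n) + (x * ((1# + N) * y) + w)
      ≈⟨ +-congʳ (+-congˡ (⋆-cong (λ k → solve 2 (λ N x → x :+ N :* x := (con (+ 1) :+ N) :* x) refl (fromℕ k) (a (suc k))) (λ _ → refl) n)) ⟩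
    (0# * x * y + ((θ a ∘ suc) ⋆ b) n) + (x * ((1# + N) * y) + w) ∎
    where
    N = fromℕ n
    x = a 0
    y = b (suc n)
    u = ((a ∘ suc) ⋆ b) n
    v = (θ (a ∘ suc) ⋆ b) n
    w = ((a ∘ suc) ⋆ θ b) n

  -- Proved for an abstract ring, because the solver's normal forms are too
  -- large once the operations unfold to real and imaginary parts.
  x∙y∙zu≈z∙xyu : ∀ x y z u → x * (y * (z * u)) ≈ z * (x * y * u)
  x∙y∙zu≈z∙xyu = solve 4 (λ x y z u → x :* (y :* (z :* u)) := z :* (x :* y :* u)) refl

  x∙yz≈yx∙z : ∀ x y z → x * (y * z) ≈ y * x * z
  x∙yz≈yx∙z = solve 3 (λ x y z → x :* (y :* z) := y :* x :* z) refl

  product-error : ∀ x y p z w → x * (y - w) + (x - z) * w + - (x * y - p) ≈ p - z * w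
  product-error = solve 5 (λ x y p z w → x :* (y :- w) :+ (x :- z) :* w :+ (:- (x :* y :- p)) := p :- z :* w) refl

  -- a n = zⁿ / n!, stated without division
  record IsExpSeries (z : Carrier) (a : Seq) : Set ℓ where
    field
      head : a 0 ≈ 1#
      step : ∀ n → θ a (suc n) ≈ z * a n

  -- For the generating series, θf = zxf and θg = wxg give θ(fg) = (z + w)xfg by the Leibniz rule.
  -- This takes the place of the binomial theorem.
  ⋆-isExpSeries : ∀ {z w a b} → IsExpSeries z a → IsExpSeries w b → IsExpSeries (z + w) (a ⋆ b)
  ⋆-isExpSeries {z} {w} {a} {b} A B = record
    { head = trans (*-cong A.head B.head) (*-identityˡ 1#)
    ; step = λ n → begin
        θ (a ⋆ b) (suc n)
          ≈⟨ θ-leibniz a b (suc n) ⟩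
        (θ a ⋆ b) (suc n) + (a ⋆ θ b) (suc n)
          ≈⟨ +-cong (+-congˡ (⋆-cong A.step (λ _ → refl) n)) (⋆-last a (θ b) n) ⟩
        (0# * a 0 * b (suc n) + ((λ k → z * a k) ⋆ b) n) + ((a ⋆ (θ b ∘ suc)) n + a (suc n) * (0# * b 0))
          ≈⟨ +-cong (+-congˡ (⋆-scaleˡ z a b n)) (+-congʳ (trans (⋆-cong (λ _ → refl) B.step n) (⋆-scaleʳ w a b n))) ⟩
        (0# * a 0 * b (suc n) + z * (a ⋆ b) n) + (w * (a ⋆ b) n + a (suc n) * (0# * b 0))
          ≈⟨ solve 7 (λ z w u a₀ b′ a′ b₀ → (con (+ 0) :* a₀ :* b′ :+ z :* u) :+ (w :* u :+ a′ :* (con (+ 0) :* b₀)) := (z :+ w) :* u) refl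
               z w ((a ⋆ b) n) (a 0) (b (suc n)) (a (suc n)) (b 0) ⟩
        (z + w) * (a ⋆ b) n ∎
    }
    where
    module A = IsExpSeries A
    module B = IsExpSeries B

  defect : Seq → Seq → ℕ → Carrier
  defect a b n = partialSum a n * partialSum b n - partialSum (a ⋆ b) n

  defect-zero : ∀ a b → 0# ≈ defect a b 0
  defect-zero a b = solve 0 (con (+ 0) := con (+ 0) :* con (+ 0) :- con (+ 0)) refl

  -- The left side collects the aᵢ bⱼ with i, j ≤ n and i + j > n, all of which have i ≥ 1. Those
  -- with j < n form the defect of the shifted sequence; those with j = n form the last summand.
  defect-suc : ∀ a b n → defect a b (suc n) ≈ defect (a ∘ suc) b n + partialSum (a ∘ suc) n * b n
  defect-suc a b n = begin
    (a₀ + A) * (b₀ + B) - (a₀ * b₀ + partialSum ((a ⋆ b) ∘ suc) n)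
      ≈⟨ +-congˡ (-‿cong (+-congˡ (trans (∑-distrib-+ {n} (λ k → a₀ * b (suc (toℕ k))) (λ k → (((a ∘ suc) ⋆ b) (toℕ k))))
           (+-congʳ (sym (*-distribˡ-sum {n} a₀ (b ∘ suc ∘ toℕ))))))) ⟩
    (a₀ + A) * (b₀ + B) - (a₀ * b₀ + (a₀ * B + C))
      ≈⟨ solve 5 (λ a₀ b₀ A B C → (a₀ :+ A) :* (b₀ :+ B) :- (a₀ :* b₀ :+ (a₀ :* B :+ C)) := A :* (b₀ :+ B) :- C) refl a₀ b₀ A B C ⟩
    A * (b₀ + B) - C
      ≈⟨ +-congʳ (*-congˡ (partialSum-last b n)) ⟩
    A * (partialSum b n + b n) - C
      ≈⟨ solve 4 (λ A B bₙ C → A :* (B :+ bₙ) :- C := (A :* B :- C) :+ A :* bₙ) refl A (partialSum b n) (b n) C ⟩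
    (A * partialSum b n - C) + A * b n ∎
    where
    a₀ = a 0
    b₀ = b 0
    A = partialSum (a ∘ suc) n
    B = partialSum (b ∘ suc) n
    C = partialSum ((a ∘ suc) ⋆ b) n

-- Convergence of the exponential series and its functional equation

module Exponential {c ℓ₁ ℓ₂} (R : RealNumbers c ℓ₁ ℓ₂) where

  open Complex R
  open RealProperties R
  open ComplexRing R

  module Rℝ where
    open CommutativeRing ℝ.commutativeRing public
    open IntegerCoefficients ℝ.commutativeRing public
    open Mult semiring public using (×1-homo-*)

  module Rℂ where
    open CommutativeRing ℂ-commutativeRing public
    open RingProperties ring public using (-‿distribʳ-*)
    open Multiples semiring public using (×ᵤ≈×)
    open Sum semiring public using (sum-cong-≋; *-distribˡ-sum)

  open Convolution ℂ-commutativeRing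
  open Rℝ using (_:=_; _:+_; _:*_; _:-_; con)

  convergesTo-resp : ∀ {s t x y} → (∀ n → s n ℝ.≈ t n) → x ℝ.≈ y → s ℝ.ConvergesTo x → t ℝ.ConvergesTo y
  convergesTo-resp s≈t x≈y h ε ε>0 with h ε ε>0
  ... | N , p = N , λ n N≤n →
    box⇒within (box-resp Rℝ.refl (Rℝ.+-cong (s≈t n) (Rℝ.-‿cong x≈y)) (within⇒box (p n N≤n)))

  convergesTo-neg : ∀ {s x} → s ℝ.ConvergesTo x → (λ n → ℝ.- s n) ℝ.ConvergesTo (ℝ.- x)
  convergesTo-neg {s} {x} h ε ε>0 with h ε ε>0
  ... | N , p = N , λ n N≤n → box⇒within (box-resp Rℝ.refl
    (Rℝ.solve 2 (λ s x → Rℝ.:- (s :- x) := (Rℝ.:- s) :- (Rℝ.:- x)) Rℝ.refl (s n) x)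
    (box-neg (within⇒box (p n N≤n))))

  convergesTo-unique : ∀ {s x y} → s ℝ.ConvergesTo x → s ℝ.ConvergesTo y → x ℝ.≈ y
  convergesTo-unique {s} {x} {y} h k = Rℝ.trans (Rℝ.solve 2 (λ x y → x := (x :- y) :+ y) Rℝ.refl x y)
    (Rℝ.trans (Rℝ.+-congʳ (box⇒≈0 bound)) (Rℝ.+-identityˡ y))
    where
    bound : ∀ ε → Positive ε → Box ε (x ℝ.- y)
    bound ε ε>0 with h (ε ℝ.* ½) (ε>0 ⊛ positive-½) | k (ε ℝ.* ½) (ε>0 ⊛ positive-½)
    ... | M , p | N , q = box-resp
      (Rℝ.trans (Rℝ.sym (Rℝ.distribˡ ε ½ ½)) (Rℝ.trans (Rℝ.*-congˡ ½+½≈1) (Rℝ.*-identityʳ ε)))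
      (Rℝ.solve 3 (λ s x y → (s :- y) :+ (Rℝ.:- (s :- x)) := x :- y) Rℝ.refl (s n) x y)
      (box-+ (within⇒box (q n (ℕ.m≤n⊔m M N))) (box-neg (within⇒box (p n (ℕ.m≤m⊔n M N)))))
      where n = M ℕ.⊔ N

  -- Chosen so that `partialSum (expTerm z)` unfolds to `expPartialSum z`.
  expTerm : ℂ → ℕ → ℂ
  expTerm z n = real (ℝ._/_ ℝ.1# (n !) {{n !≢0}}) * z ^ n

  fromℕ-real : ∀ n → fromℕ n ≈ real (ℝ.fromℕ n)
  fromℕ-real zero    = Rℂ.refl
  fromℕ-real (suc n) = Rℂ.trans (Rℂ.+-congˡ (fromℕ-real n)) (Rℝ.refl , Rℝ.+-identityˡ _)

  /-* : ∀ n .{{_ : NonZero n}} → ℝ.fromℕ n ℝ.* (ℝ.1# ℝ./ n) ℝ.≈ ℝ.1#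
  /-* n = Rℝ.trans (Rℝ.*-congˡ (Rℝ.*-identityˡ _)) (*-inverse (ℝ.fromℕ n) (inj₂ (ℝ.fromℕ-positive n)))

  [1+n]/[1+n]! : ∀ n → ℝ.fromℕ (suc n) ℝ.* ℝ._/_ ℝ.1# (suc n !) {{suc n !≢0}} ℝ.≈ ℝ._/_ ℝ.1# (n !) {{n !≢0}}
  [1+n]/[1+n]! n = begin
    N ℝ.* x                  ≈⟨ Rℝ.*-identityʳ _ ⟨
    N ℝ.* x ℝ.* ℝ.1#         ≈⟨ Rℝ.*-congˡ (/-* (n !) {{n !≢0}}) ⟨
    N ℝ.* x ℝ.* (F ℝ.* y)    ≈⟨ Rℝ.solve 4 (λ N x F y → N :* x :* (F :* y) := N :* F :* x :* y) Rℝ.refl N x F y ⟩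
    N ℝ.* F ℝ.* x ℝ.* y      ≈⟨ Rℝ.*-congʳ (Rℝ.*-congʳ (Rℝ.×1-homo-* (suc n) (n !))) ⟨
    ℝ.fromℕ (suc n !) ℝ.* x ℝ.* y ≈⟨ Rℝ.*-congʳ (/-* (suc n !) {{suc n !≢0}}) ⟩
    ℝ.1# ℝ.* y               ≈⟨ Rℝ.*-identityˡ y ⟩
    y ∎
    where
    open SetoidReasoning Rℝ.setoid
    N = ℝ.fromℕ (suc n)
    F = ℝ.fromℕ (n !)
    x = ℝ._/_ ℝ.1# (suc n !) {{suc n !≢0}}
    y = ℝ._/_ ℝ.1# (n !) {{n !≢0}}

  expTerm-isExpSeries : ∀ z → IsExpSeries z (expTerm z)
  expTerm-isExpSeries z = record
    { head = Rℂ.trans (Rℂ.*-identityʳ _)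
        (Rℝ.trans (Rℝ.sym (Rℝ.trans (Rℝ.*-congʳ (Rℝ.+-identityʳ ℝ.1#)) (Rℝ.*-identityˡ _))) (/-* 1) , Rℝ.refl)
    ; step = λ n →
        let x = ℝ._/_ ℝ.1# (suc n !) {{suc n !≢0}}
            y = ℝ._/_ ℝ.1# (n !) {{n !≢0}}
        in begin
        fromℕ (suc n) * (real x * (z * z ^ n))
          ≈⟨ Rℂ.*-congʳ (fromℕ-real (suc n)) ⟩
        real (ℝ.fromℕ (suc n)) * (real x * (z * z ^ n))
          ≈⟨ x∙y∙zu≈z∙xyu _ _ z (z ^ n) ⟩
        z * (real (ℝ.fromℕ (suc n)) * real x * z ^ n)
          ≈⟨ Rℂ.*-congˡ (Rℂ.*-congʳ (Rℂ.trans (Rℂ.sym (real-* _ x)) ([1+n]/[1+n]! n , Rℝ.refl))) ⟩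
        z * (real y * z ^ n) ∎
    }
    where
    open SetoidReasoning Rℂ.setoid

  -- The recurrence determines each term from the previous one because 1 + n is invertible. This is
  -- what identifies the Cauchy product of two exponential series with the series of the sum.
  isExpSeries-unique : ∀ {z a b} → IsExpSeries z a → IsExpSeries z b → ∀ n → a n ≈ b n
  isExpSeries-unique A B zero = Rℂ.trans (IsExpSeries.head A) (Rℂ.sym (IsExpSeries.head B))
  isExpSeries-unique {z} {a} {b} A B (suc n) = begin
    a (suc n)                                  ≈⟨ cancel (a (suc n)) ⟨
    real (ℝ.1# ℝ./ suc n) * θ a (suc n)        ≈⟨ Rℂ.*-congˡ (IsExpSeries.step A n) ⟩
    real (ℝ.1# ℝ./ suc n) * (z * a n)          ≈⟨ Rℂ.*-congˡ (Rℂ.*-congˡ (isExpSeries-unique A B n)) ⟩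
    real (ℝ.1# ℝ./ suc n) * (z * b n)          ≈⟨ Rℂ.*-congˡ (IsExpSeries.step B n) ⟨
    real (ℝ.1# ℝ./ suc n) * θ b (suc n)        ≈⟨ cancel (b (suc n)) ⟩
    b (suc n)                                  ∎
    where
    open SetoidReasoning Rℂ.setoid
    cancel : ∀ w → real (ℝ.1# ℝ./ suc n) * (fromℕ (suc n) * w) ≈ w
    cancel w = begin
      real (ℝ.1# ℝ./ suc n) * (fromℕ (suc n) * w)
        ≈⟨ x∙yz≈yx∙z _ _ w ⟩
      fromℕ (suc n) * real (ℝ.1# ℝ./ suc n) * w
        ≈⟨ Rℂ.*-congʳ (Rℂ.trans (Rℂ.*-congʳ (fromℕ-real (suc n))) (Rℂ.sym (real-* _ _))) ⟩
      real (ℝ.fromℕ (suc n) ℝ.* (ℝ.1# ℝ./ suc n)) * w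
        ≈⟨ Rℂ.*-congʳ {w} (/-* (suc n) , Rℝ.refl) ⟩
      1# * w
        ≈⟨ Rℂ.*-identityˡ w ⟩
      w ∎

  Dominated : ℝ → ℝ → (ℕ → ℂ) → Set ℓ₂
  Dominated ρ C a = ∀ n → BoxC (C ℝ.* pow ρ n) (a n)

  dominated-tail : ∀ {ρ C a} → Dominated ρ C a → Dominated ρ (C ℝ.* ρ) (a ∘ suc)
  dominated-tail {ρ} {C} h n = boxC-resp (Rℝ.sym (Rℝ.*-assoc C ρ (pow ρ n))) Rℂ.refl (h (suc n))

  dominated-untail : ∀ {ρ C a} → Positive ρ → Dominated ρ C (a ∘ suc) → ∃[ C′ ] Dominated ρ C′ a
  dominated-untail {ρ} {C} {a} ρ>0 h with ∃-boxC (a 0)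
  -- `C ρ⁻¹` compensates for the index shift, and `B` bounds the term at index 0.
  ... | B , p = C ℝ.* ρ⁻¹ ℝ.+ B , λ where
      zero → boxC-mono
        (positive-resp (Rℝ.solve 3 (λ C r B → C :* r := (C :* r :+ B) :* con (+ 1) :- B) Rℝ.refl C ρ⁻¹ B)
          (C>0 ⊛ positive-inverse ρ>0)) p
      (suc n) → boxC-mono
        (positive-resp (eq (pow ρ n)) (box-bound (proj₁ p) ⊛ (ρ>0 ⊛ positive-pow ρ>0 n))) (h n)
    where
    ρ⁻¹ = ℝ.inverse ρ (inj₂ ρ>0)
    C>0 : Positive C
    C>0 = positive-resp (Rℝ.*-identityʳ C) (box-bound (proj₁ (h 0)))
    eq : ∀ s → B ℝ.* (ρ ℝ.* s) ℝ.≈ (C ℝ.* ρ⁻¹ ℝ.+ B) ℝ.* (ρ ℝ.* s) ℝ.- C ℝ.* s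
    eq s = Rℝ.sym (Rℝ.trans
      (Rℝ.solve 5 (λ C r B ρ s → (C :* r :+ B) :* (ρ :* s) :- C :* s := B :* (ρ :* s) :+ C :* s :* (ρ :* r :- con (+ 1))) Rℝ.refl C ρ⁻¹ B ρ s)
      (Rℝ.trans (Rℝ.+-congˡ (Rℝ.*-congˡ (Rℝ.+-congʳ (*-inverse ρ (inj₂ ρ>0)))))
        (Rℝ.solve 2 (λ x y → x :+ y :* (con (+ 1) :- con (+ 1)) := x) Rℝ.refl _ _)))

  dominated-cong : ∀ {ρ C a b} → (∀ n → a n ≈ b n) → Dominated ρ C a → Dominated ρ C b
  dominated-cong a≈b h n = boxC-resp Rℝ.refl (a≈b n) (h n)

  dominated-undrop : ∀ {ρ} N {C a} → Positive ρ → Dominated ρ C (λ n → a (n ℕ.+ N)) → ∃[ C′ ] Dominated ρ C′ a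
  dominated-undrop zero {a = a} ρ>0 h = _ , dominated-cong (λ n → Rℂ.reflexive (≡.cong a (ℕ.+-identityʳ n))) h
  dominated-undrop (suc N) {a = a} ρ>0 h =
    dominated-undrop N ρ>0 (proj₂ (dominated-untail ρ>0
      (dominated-cong (λ n → Rℂ.reflexive (≡.cong a (ℕ.+-suc n N))) h)))

  -- From index 2M/ρ on, where z is bounded by M, the quotients of successive terms are below ρ.
  isExpSeries-dominated : ∀ {ρ z a} → Positive ρ → IsExpSeries z a → ∃[ C ] Dominated ρ C a
  isExpSeries-dominated {ρ} {z} {a} ρ>0 A with ∃-boxC z
  ... | M , z<M with ℝ.archimedean (2# ℝ.* M ℝ.* ℝ.inverse ρ (inj₂ ρ>0))
  ... | N , 2M/ρ<N with ∃-boxC (a N)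
  ... | C , aN<C = dominated-undrop N ρ>0 drop
    where
    ρ⁻¹ = ℝ.inverse ρ (inj₂ ρ>0)
    drop : Dominated ρ C (λ n → a (n ℕ.+ N))
    drop zero    = boxC-resp (Rℝ.sym (Rℝ.*-identityʳ C)) Rℂ.refl aN<C
    -- By the recurrence, L a(k+1) = z a(k) is bounded by 2MCρⁿ, the 2 being that of `boxC-*`. This
    -- is below L C ρⁿ⁺¹ since L > 2M/ρ, and then L is cancelled.
    drop (suc n) = boxC-cancel (ℝ.fromℕ-positive (suc k))
      (boxC-mono (positive-resp (eq L (pow ρ n)) (box-bound (proj₁ aN<C) ⊛ positive-pow ρ>0 n ⊛ ρ>0 ⊛ <⇒positive 2M/ρ<L))
        (boxC-resp Rℝ.refl (Rℂ.trans (Rℂ.sym (IsExpSeries.step A k)) (Rℂ.*-congʳ (fromℕ-real (suc k)))) (boxC-* z<M (drop n))))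
      where
      k = n ℕ.+ N
      L = ℝ.fromℕ (suc k)
      2M/ρ<L : 2# ℝ.* M ℝ.* ρ⁻¹ ℝ.< L
      2M/ρ<L = below-fromℕ-mono {n = suc k} (ℕ.m≤n⇒m≤1+n (ℕ.m≤n+m N n)) 2M/ρ<N
      eq : ∀ L s → C ℝ.* s ℝ.* ρ ℝ.* (L ℝ.- 2# ℝ.* M ℝ.* ρ⁻¹) ℝ.≈ L ℝ.* (C ℝ.* (ρ ℝ.* s)) ℝ.- (M ℝ.* (C ℝ.* s) ℝ.+ M ℝ.* (C ℝ.* s))
      eq L s = Rℝ.trans
        (Rℝ.solve 6 (λ C s ρ L M r → C :* s :* ρ :* (L :- con (+ 2) :* M :* r)
            := (L :* (C :* (ρ :* s)) :- (M :* (C :* s) :+ M :* (C :* s))) :+ con (+ 2) :* C :* s :* M :* (con (+ 1) :- ρ :* r))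
            Rℝ.refl C s ρ L M ρ⁻¹)
        (Rℝ.trans (Rℝ.+-congˡ (Rℝ.*-congˡ (Rℝ.+-congˡ (Rℝ.-‿cong (*-inverse ρ (inj₂ ρ>0))))))
          (Rℝ.solve 2 (λ x y → x :+ y :* (con (+ 1) :- con (+ 1)) := x) Rℝ.refl _ _))

  ¼ : ℝ
  ¼ = ½ ℝ.* ½

  dominated-constant : ∀ {ρ C a} → Dominated ρ C a → Positive C
  dominated-constant {C = C} h = positive-resp (Rℝ.*-identityʳ C) (box-bound (proj₁ (h 0)))

  -- Induction through the tail, whose constant is C/4: the head and the tail together stay below C
  -- + 2 · C/4 = 3C/2 < 2C.
  partialSum-bounded : ∀ {C a} → Dominated ¼ C a → ∀ n → BoxC (2# ℝ.* C) (partialSum a n)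
  partialSum-bounded h zero = boxC-0 (positive-2 ⊛ dominated-constant h)
  partialSum-bounded {C} {a} h (suc n) = boxC-mono
    (positive-resp eq (positive-2 ⊛ C>0 ⊛ (positive-½ ⊛ positive-½)))
    (boxC-+ (h 0) (partialSum-bounded (dominated-tail h) n))
    where
    C>0 = dominated-constant h
    eq : 2# ℝ.* C ℝ.* (½ ℝ.* ½) ℝ.≈ 2# ℝ.* C ℝ.- (C ℝ.* ℝ.1# ℝ.+ 2# ℝ.* (C ℝ.* (½ ℝ.* ½)))
    eq = Rℝ.trans
      (Rℝ.solve 2 (λ C h → con (+ 2) :* C :* (h :* h) := C :* ((h :+ h) :* (h :+ h)) :- con (+ 2) :* (C :* (h :* h))) Rℝ.refl C ½)
      (Rℝ.trans (Rℝ.+-congʳ (Rℝ.*-congˡ (Rℝ.*-cong ½+½≈1 ½+½≈1)))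
        (Rℝ.solve 2 (λ C x → C :* (con (+ 1) :* con (+ 1)) :- x := con (+ 2) :* C :- (C :* con (+ 1) :+ x)) Rℝ.refl C _))

  -- The two rates differ in order that the error 4CC′/2ⁿ is reproduced exactly by defect-suc.
  defect-bounded : ∀ {C C′ a b} → Dominated ¼ C a → Dominated ½ C′ b → ∀ n →
    BoxC ((2# ℝ.+ 2#) ℝ.* C ℝ.* C′ ℝ.* pow ½ n) (defect a b n)
  defect-bounded {a = a} {b} h k zero = boxC-resp Rℝ.refl (defect-zero a b)
    (boxC-0 ((positive-2 ⊕ positive-2) ⊛ dominated-constant h ⊛ dominated-constant k ⊛ positive-1))
  defect-bounded {C} {C′} {a} {b} h k (suc n) = boxC-resp eq (Rℂ.sym (defect-suc a b n))
    (boxC-+ (defect-bounded (dominated-tail h) k n) (boxC-* (partialSum-bounded (dominated-tail h) n) (k n)))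
    where
    s = pow ½ n
    eq : (2# ℝ.+ 2#) ℝ.* (C ℝ.* (½ ℝ.* ½)) ℝ.* C′ ℝ.* s
         ℝ.+ (2# ℝ.* (C ℝ.* (½ ℝ.* ½)) ℝ.* (C′ ℝ.* s) ℝ.+ 2# ℝ.* (C ℝ.* (½ ℝ.* ½)) ℝ.* (C′ ℝ.* s))
         ℝ.≈ (2# ℝ.+ 2#) ℝ.* C ℝ.* C′ ℝ.* (½ ℝ.* s)
    eq = Rℝ.trans
      (Rℝ.solve 4 (λ C C′ h s → (con (+ 2) :+ con (+ 2)) :* (C :* (h :* h)) :* C′ :* s
           :+ (con (+ 2) :* (C :* (h :* h)) :* (C′ :* s) :+ con (+ 2) :* (C :* (h :* h)) :* (C′ :* s))
           := (con (+ 2) :+ con (+ 2)) :* C :* C′ :* (h :* s) :* (h :+ h)) Rℝ.refl C C′ ½ s)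
      (Rℝ.trans (Rℝ.*-congˡ ½+½≈1) (Rℝ.*-identityʳ _))

  hasExp-intro : ∀ {z w} → (∀ ε → Positive ε → ∃[ N ] (∀ n → N ℕ.≤ n → BoxC ε (expPartialSum z n + - w))) → HasExp z w
  hasExp-intro h =
    (λ ε ε>0 → proj₁ (h ε ε>0) , λ n N≤n → box⇒within (proj₁ (proj₂ (h ε ε>0) n N≤n))) ,
    (λ ε ε>0 → proj₁ (h ε ε>0) , λ n N≤n → box⇒within (proj₂ (proj₂ (h ε ε>0) n N≤n)))

  hasExp-elim : ∀ {z w} → HasExp z w → ∀ ε → Positive ε → ∃[ N ] (∀ n → N ℕ.≤ n → BoxC ε (expPartialSum z n + - w))
  hasExp-elim (h , k) ε ε>0 with h ε ε>0 | k ε ε>0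
  ... | M , p | N , q = M ℕ.⊔ N , λ n M⊔N≤n →
    within⇒box (p n (ℕ.m⊔n≤o⇒m≤o M N M⊔N≤n)) , within⇒box (q n (ℕ.m⊔n≤o⇒n≤o M N M⊔N≤n))

  hasExp-unique : ∀ {z w w′} → HasExp z w → HasExp z w′ → w ≈ w′
  hasExp-unique (h , k) (h′ , k′) = convergesTo-unique h h′ , convergesTo-unique k k′

  ^-cong : ∀ {z z′} → z ≈ z′ → ∀ n → z ^ n ≈ z′ ^ n
  ^-cong z≈ zero    = Rℂ.refl
  ^-cong z≈ (suc n) = Rℂ.*-cong z≈ (^-cong z≈ n)

  expPartialSum-cong : ∀ {z z′} → z ≈ z′ → ∀ n → expPartialSum z n ≈ expPartialSum z′ n
  expPartialSum-cong {z} {z′} z≈ = partialSum-cong {expTerm z} {expTerm z′} (λ n → Rℂ.*-congˡ (^-cong z≈ n))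

  hasExp-resp : ∀ {z z′ w w′} → z ≈ z′ → w ≈ w′ → HasExp z w → HasExp z′ w′
  hasExp-resp z≈ (p , q) (h , k) =
    convergesTo-resp (λ n → proj₁ (expPartialSum-cong z≈ n)) p h ,
    convergesTo-resp (λ n → proj₂ (expPartialSum-cong z≈ n)) q k

  conj-^ : ∀ z n → conj (z ^ n) ≈ conj z ^ n
  conj-^ z zero    = conj-real ℝ.1#
  conj-^ z (suc n) = Rℂ.trans (conj-* z (z ^ n)) (Rℂ.*-congˡ (conj-^ z n))

  conj-partialSum : ∀ a n → conj (partialSum a n) ≈ partialSum (conj ∘ a) n
  conj-partialSum a zero    = conj-real ℝ.0#
  conj-partialSum a (suc n) = Rℂ.trans (conj-+ (a 0) _) (Rℂ.+-congˡ (conj-partialSum (a ∘ suc) n))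

  -- The coefficients 1/n! are real, so conjugation passes through every partial sum.
  hasExp-conj : ∀ {z w} → HasExp z w → HasExp (conj z) (conj w)
  hasExp-conj {z} (h , k) =
    convergesTo-resp (λ n → proj₁ (eq n)) Rℝ.refl h ,
    convergesTo-resp (λ n → proj₂ (eq n)) Rℝ.refl (convergesTo-neg k)
    where
    eq : ∀ n → conj (expPartialSum z n) ≈ expPartialSum (conj z) n
    eq n = Rℂ.trans (conj-partialSum (expTerm z) n) (partialSum-cong {conj ∘ expTerm z} {expTerm (conj z)}
      (λ n → Rℂ.trans (conj-* _ (z ^ n)) (Rℂ.*-cong (conj-real _) (conj-^ z n))) n)

  hasExp-0 : HasExp 0# 1#
  -- The empty partial sum is 0, so the value 1 is reached only from index 1 on.
  hasExp-0 = hasExp-intro λ ε ε>0 → 1 , λ { (suc n) _ → boxC-resp Rℝ.refl (Rℂ.sym (error≈0 n)) (boxC-0 ε>0) }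
    where
    tail≈0 : ∀ n → partialSum (expTerm 0# ∘ suc) n ≈ 0#
    tail≈0 zero    = Rℂ.refl
    tail≈0 (suc n) = Rℂ.trans (partialSum-last (expTerm 0# ∘ suc) n) (Rℂ.trans
      (Rℂ.+-cong (tail≈0 n) (Rℂ.trans (Rℂ.*-congˡ (Rℂ.zeroˡ (0# ^ n))) (Rℂ.zeroʳ _))) (Rℂ.+-identityˡ _))
    error≈0 : ∀ n → expPartialSum 0# (suc n) + - 1# ≈ 0#
    error≈0 n = Rℂ.trans
      (Rℂ.+-congʳ {x = - 1#} (Rℂ.trans (Rℂ.+-cong (IsExpSeries.head (expTerm-isExpSeries 0#)) (tail≈0 n)) (Rℂ.+-identityʳ _)))
      (Rℂ.-‿inverseʳ 1#)

  hasExp-+ : ∀ {z z′ w w′} → HasExp z w → HasExp z′ w′ → HasExp (z + z′) (w * w′)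
  hasExp-+ {z} {z′} {w} {w′} h h′
    with isExpSeries-dominated (positive-½ ⊛ positive-½) (expTerm-isExpSeries z)
       | isExpSeries-dominated positive-½ (expTerm-isExpSeries z′)
       | ∃-boxC w′
  ... | C , a<C | C′ , b<C′ | W , w′<W = hasExp-intro limit
    where
    a = expTerm z
    b = expTerm z′
    4CC′ = (2# ℝ.+ 2#) ℝ.* C ℝ.* C′
    -- One summand for each error term: a partial sum of `a`, below 2C, times the error of `b`; the
    -- error of `a` times `w′`, below W; and the defect. The doubling in `boxC-*` makes the first
    -- two 4C and 2W.
    L = ((2# ℝ.+ 2#) ℝ.* C ℝ.+ 2# ℝ.* W) ℝ.+ 4CC′
    4CC′>0 : Positive 4CC′
    4CC′>0 = (positive-2 ⊕ positive-2) ⊛ dominated-constant a<C ⊛ dominated-constant b<C′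
    L>0 : Positive L
    L>0 = (positive-2 ⊕ positive-2) ⊛ dominated-constant a<C ⊕ positive-2 ⊛ box-bound (proj₁ w′<W) ⊕ 4CC′>0
    L⁻¹ = ℝ.inverse L (inj₂ L>0)

    ⋆≈expTerm : ∀ n → (a ⋆ b) n ≈ expTerm (z + z′) n
    ⋆≈expTerm = isExpSeries-unique (⋆-isExpSeries (expTerm-isExpSeries z) (expTerm-isExpSeries z′)) (expTerm-isExpSeries (z + z′))

    error : ∀ n η → BoxC η (expPartialSum z n + - w) → BoxC η (expPartialSum z′ n + - w′) → Positive (η ℝ.- pow ½ n) →
      BoxC (L ℝ.* η) (expPartialSum (z + z′) n + - (w * w′))
    error n η p q r = boxC-resp
      (Rℝ.solve 4 (λ C W D η → ((con (+ 2) :* C :* η :+ con (+ 2) :* C :* η) :+ (η :* W :+ η :* W)) :+ D :* η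
          := (((con (+ 2) :+ con (+ 2)) :* C :+ con (+ 2) :* W) :+ D) :* η) Rℝ.refl C W 4CC′ η)
      (Rℂ.trans (product-error (partialSum a n) (partialSum b n) (partialSum (a ⋆ b) n) w w′)
        (Rℂ.+-congʳ {x = - (w * w′)} (partialSum-cong ⋆≈expTerm n)))
      (boxC-+ (boxC-+ (boxC-* (partialSum-bounded a<C n) q) (boxC-* p w′<W))
        (boxC-neg (boxC-mono (positive-resp (Rℝ.solve 3 (λ D η s → D :* (η :- s) := D :* η :- D :* s) Rℝ.refl 4CC′ η (pow ½ n)) (4CC′>0 ⊛ r))
          (defect-bounded a<C b<C′ n))))

    limit : ∀ ε → Positive ε → ∃[ N ] (∀ n → N ℕ.≤ n → BoxC ε (expPartialSum (z + z′) n + - (w * w′)))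
    limit ε ε>0 = N₁ ℕ.⊔ N₂ ℕ.⊔ N₃ , λ n N≤n → boxC-resp Lη≈ε Rℂ.refl (error n η
        (proj₂ bound₁ n (ℕ.m⊔n≤o⇒m≤o N₁ N₂ (ℕ.m⊔n≤o⇒m≤o _ N₃ N≤n)))
        (proj₂ bound₂ n (ℕ.m⊔n≤o⇒n≤o N₁ N₂ (ℕ.m⊔n≤o⇒m≤o _ N₃ N≤n)))
        (proj₂ bound₃ n (ℕ.m⊔n≤o⇒n≤o (N₁ ℕ.⊔ N₂) N₃ N≤n)))
      where
      η = L⁻¹ ℝ.* ε
      η>0 : Positive η
      η>0 = positive-inverse L>0 ⊛ ε>0
      Lη≈ε : L ℝ.* η ℝ.≈ ε
      Lη≈ε = Rℝ.trans (Rℝ.sym (Rℝ.*-assoc L L⁻¹ ε)) (Rℝ.trans (Rℝ.*-congʳ (*-inverse L (inj₂ L>0))) (Rℝ.*-identityˡ ε))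
      bound₁ = hasExp-elim h η η>0
      bound₂ = hasExp-elim h′ η η>0
      bound₃ = ½ⁿ-null η η>0
      N₁ = proj₁ bound₁
      N₂ = proj₁ bound₂
      N₃ = proj₁ bound₃

-- The Eisenstein integers and their evaluation at a root of 1 + x + x²

infix 5 _+ω_
record ℤ[ω] : Set where
  constructor _+ω_
  field
    constant slope : ℤ
open ℤ[ω]

_≟ω_ : DecidableEquality ℤ[ω]
(a +ω b) ≟ω (c +ω d) = map′ (λ (p , q) → ≡.cong₂ _+ω_ p q) (λ p → ≡.cong constant p , ≡.cong slope p)
  ((a ℤ.≟ c) ×-dec (b ℤ.≟ d))

-- Multiplication reduces ω² to - 1 - ω.
ℤ[ω]-rawRing : RawRing 0ℓ 0ℓ
ℤ[ω]-rawRing = record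
  { Carrier = ℤ[ω]
  ; _≈_     = _≡_
  ; _+_     = λ (a +ω b) (c +ω d) → a ℤ.+ c +ω b ℤ.+ d
  ; _*_     = λ (a +ω b) (c +ω d) → (a ℤ.* c ℤ.- b ℤ.* d) +ω ((a ℤ.* d ℤ.+ b ℤ.* c) ℤ.- b ℤ.* d)
  ; -_      = λ (a +ω b) → ℤ.- a +ω ℤ.- b
  ; 0#      = 0ℤ +ω 0ℤ
  ; 1#      = 1ℤ +ω 0ℤ
  }

module E where
  open RawRing ℤ[ω]-rawRing public using (_+_; _*_; -_; 0#; 1#)
  open RawMonoidOps (RawRing.+-rawMonoid ℤ[ω]-rawRing) public using (sum)

  ω : ℤ[ω]
  ω = 0ℤ +ω 1ℤ

  -- The automorphism sending ω to ω² = - 1 - ω.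
  conj : ℤ[ω] → ℤ[ω]
  conj (a +ω b) = (a ℤ.- b) +ω ℤ.- b

  -- The product of x and its conjugate, which lies in ℤ.
  norm : ℤ[ω] → ℤ
  norm (a +ω b) = (a ℤ.* a ℤ.- a ℤ.* b) ℤ.+ b ℤ.* b

module Evaluation {c ℓ} (CR : CommutativeRing c ℓ) where

  open CommutativeRing CR hiding (zero)
  open IntegerCoefficients CR
  open Sum semiring using (sum)
  open SetoidReasoning setoid

  module At (ω : Carrier) (1+ω+ω²≈0 : 1# + ω + ω * ω ≈ 0#) where

    ⟦_⟧ω : ℤ[ω] → Carrier
    ⟦ a +ω b ⟧ω = fromℤ a + fromℤ b * ω

    ⟦0⟧ : ⟦ E.0# ⟧ω ≈ 0#
    ⟦0⟧ = solve 1 (λ ω → con 0ℤ :+ con 0ℤ :* ω := con 0ℤ) refl ω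

    ⟦1⟧ : ⟦ E.1# ⟧ω ≈ 1#
    ⟦1⟧ = solve 1 (λ ω → con 1ℤ :+ con 0ℤ :* ω := con 1ℤ) refl ω

    ⟦ω⟧ : ⟦ E.ω ⟧ω ≈ ω
    ⟦ω⟧ = solve 1 (λ ω → con 0ℤ :+ con 1ℤ :* ω := ω) refl ω

    ⟦⟧-neg : ∀ x → ⟦ E.- x ⟧ω ≈ - ⟦ x ⟧ω
    ⟦⟧-neg (a +ω b) = begin
      fromℤ (ℤ.- a) + fromℤ (ℤ.- b) * ω ≈⟨ +-cong (fromℤ-neg a) (*-congʳ (fromℤ-neg b)) ⟩
      - fromℤ a + - fromℤ b * ω ≈⟨ solve 3 (λ a b ω → :- a :+ (:- b) :* ω := :- (a :+ b :* ω)) refl (fromℤ a) (fromℤ b) ω ⟩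
      - (fromℤ a + fromℤ b * ω) ∎

    ⟦⟧-+ : ∀ x y → ⟦ x E.+ y ⟧ω ≈ ⟦ x ⟧ω + ⟦ y ⟧ω
    ⟦⟧-+ (a +ω b) (c +ω d) = begin
      fromℤ (a ℤ.+ c) + fromℤ (b ℤ.+ d) * ω ≈⟨ +-cong (fromℤ-+ a c) (*-congʳ (fromℤ-+ b d)) ⟩
      (fromℤ a + fromℤ c) + (fromℤ b + fromℤ d) * ω
        ≈⟨ solve 5 (λ a b c d ω → (a :+ c) :+ (b :+ d) :* ω := (a :+ b :* ω) :+ (c :+ d :* ω)) refl (fromℤ a) (fromℤ b) (fromℤ c) (fromℤ d) ω ⟩
      (fromℤ a + fromℤ b * ω) + (fromℤ c + fromℤ d * ω) ∎

    private
      fromℤ-+* : ∀ i j k l → fromℤ (i ℤ.* j ℤ.+ k ℤ.* l) ≈ fromℤ i * fromℤ j + fromℤ k * fromℤ l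
      fromℤ-+* i j k l = trans (fromℤ-+ (i ℤ.* j) (k ℤ.* l)) (+-cong (fromℤ-* i j) (fromℤ-* k l))

      fromℤ-- : ∀ i j k → fromℤ (i ℤ.- j ℤ.* k) ≈ fromℤ i - fromℤ j * fromℤ k
      fromℤ-- i j k = trans (fromℤ-+ i (ℤ.- (j ℤ.* k))) (+-congˡ (trans (fromℤ-neg (j ℤ.* k)) (-‿cong (fromℤ-* j k))))

      -- The solver treats ω as an indeterminate. Identities that hold only modulo 1 + ω + ω² become
      -- polynomial identities once the right multiple of it is added.
      drop-multiple : ∀ x y → x + y * (1# + ω + ω * ω) ≈ x
      drop-multiple x y = trans (+-congˡ (trans (*-congˡ 1+ω+ω²≈0) (zeroʳ y))) (+-identityʳ x)

    ⟦⟧-* : ∀ x y → ⟦ x E.* y ⟧ω ≈ ⟦ x ⟧ω * ⟦ y ⟧ω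
    ⟦⟧-* (a +ω b) (c +ω d) = begin
      fromℤ (a ℤ.* c ℤ.- b ℤ.* d) + fromℤ ((a ℤ.* d ℤ.+ b ℤ.* c) ℤ.- b ℤ.* d) * ω
        ≈⟨ +-cong (trans (fromℤ-- (a ℤ.* c) b d) (+-congʳ (fromℤ-* a c)))
             (*-congʳ (trans (fromℤ-- (a ℤ.* d ℤ.+ b ℤ.* c) b d) (+-congʳ (fromℤ-+* a d b c)))) ⟩
      (A * C - B * D) + ((A * D + B * C) - B * D) * ω
        ≈⟨ drop-multiple _ (B * D) ⟨
      (A * C - B * D) + ((A * D + B * C) - B * D) * ω + B * D * (1# + ω + ω * ω)
        ≈⟨ solve 5 (λ a b c d ω → (a :* c :- b :* d) :+ ((a :* d :+ b :* c) :- b :* d) :* ω :+ b :* d :* (con 1ℤ :+ ω :+ ω :* ω)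
             := (a :+ b :* ω) :* (c :+ d :* ω)) refl A B C D ω ⟩
      (A + B * ω) * (C + D * ω) ∎
      where
      A = fromℤ a
      B = fromℤ b
      C = fromℤ c
      D = fromℤ d

    ⟦⟧-conj : ∀ a b → ⟦ E.conj (a +ω b) ⟧ω ≈ fromℤ a + fromℤ b * (ω * ω)
    ⟦⟧-conj a b = begin
      fromℤ (a ℤ.- b) + fromℤ (ℤ.- b) * ω
        ≈⟨ +-cong (trans (fromℤ-+ a (ℤ.- b)) (+-congˡ (fromℤ-neg b))) (*-congʳ (fromℤ-neg b)) ⟩
      (fromℤ a - fromℤ b) + - fromℤ b * ω
        ≈⟨ drop-multiple _ (fromℤ b) ⟨
      (fromℤ a - fromℤ b) + - fromℤ b * ω + fromℤ b * (1# + ω + ω * ω)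
        ≈⟨ solve 3 (λ a b ω → (a :- b) :+ (:- b) :* ω :+ b :* (con 1ℤ :+ ω :+ ω :* ω) := a :+ b :* (ω :* ω)) refl (fromℤ a) (fromℤ b) ω ⟩
      fromℤ a + fromℤ b * (ω * ω) ∎

    fromℤ-norm : ∀ x → fromℤ (E.norm x) ≈ ⟦ x ⟧ω * ⟦ E.conj x ⟧ω
    fromℤ-norm x@(a +ω b) = begin
      fromℤ ((a ℤ.* a ℤ.- a ℤ.* b) ℤ.+ b ℤ.* b)
        ≈⟨ trans (fromℤ-+ (a ℤ.* a ℤ.- a ℤ.* b) (b ℤ.* b)) (+-cong (trans (fromℤ-- (a ℤ.* a) a b) (+-congʳ (fromℤ-* a a))) (fromℤ-* b b)) ⟩
      (A * A - A * B) + B * B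
        ≈⟨ drop-multiple _ _ ⟨
      -- The cofactor is AB, for ω + ω² = - 1, plus B² (ω - 1), for ω³ - 1 = (ω - 1)(1 + ω + ω²).
      (A * A - A * B) + B * B + ((A * B - B * B) + B * B * ω) * (1# + ω + ω * ω)
        ≈⟨ solve 3 (λ a b ω → (a :* a :- a :* b) :+ b :* b :+ ((a :* b :- b :* b) :+ b :* b :* ω) :* (con 1ℤ :+ ω :+ ω :* ω)
             := (a :+ b :* ω) :* (a :+ b :* (ω :* ω))) refl A B ω ⟩
      (A + B * ω) * (A + B * (ω * ω))
        ≈⟨ *-congˡ (⟦⟧-conj a b) ⟨
      ⟦ x ⟧ω * ⟦ E.conj x ⟧ω ∎
      where
      A = fromℤ a
      B = fromℤ b

    ⟦⟧-sum : ∀ {n} (v : Fin n → ℤ[ω]) → ⟦ E.sum v ⟧ω ≈ sum (λ i → ⟦ v i ⟧ω)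
    ⟦⟧-sum {zero}  v = ⟦0⟧
    ⟦⟧-sum {suc n} v = trans (⟦⟧-+ (v zero) (E.sum (v ∘ suc))) (+-congˡ (⟦⟧-sum (v ∘ suc)))

-- The cube root of unity exp(2πi/3)

module CubeRoot {c ℓ₁ ℓ₂} (R : RealNumbers c ℓ₁ ℓ₂) where

  open Complex R
  open RealProperties R
  open ComplexRing R
  open Exponential R
  open Rℝ using (_:=_; _:+_; _:*_; _:-_; con)

  hasExp-imaginary⇒unit : ∀ {x w} → HasExp (imaginary x) w → w * conj w ≈ 1#
  hasExp-imaginary⇒unit {x} h = hasExp-unique
    (hasExp-resp (Rℝ.+-identityˡ _ , Rℝ.-‿inverseʳ x) Rℂ.refl (hasExp-+ h (hasExp-conj h))) hasExp-0

  module _ {π : ℝ} (isPi : IsPi π) where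

    exp-2πi≈1 : ∀ {w} → HasExp (imaginary π + imaginary π) w → w ≈ 1#
    exp-2πi≈1 h with IsPi.isZero isPi
    ... | u , exp-πi , im-u≈0 = Rℂ.trans (hasExp-unique h (hasExp-+ exp-πi exp-πi))
      (Rℂ.trans (Rℂ.*-congˡ {u} u≈conj-u) (hasExp-imaginary⇒unit exp-πi))
      where
      u≈conj-u : u ≈ conj u
      u≈conj-u = Rℝ.refl , Rℝ.trans im-u≈0 (Rℝ.sym (Rℝ.trans (Rℝ.-‿cong im-u≈0) (Rℝ.solve 0 (Rℝ.:- con 0ℤ := con 0ℤ) Rℝ.refl)))

    private
      ⅓ : ℝ
      ⅓ = ℝ.inverse (ℝ.fromℕ 3) (inj₂ (ℝ.fromℕ-positive 3))

      3*⅓≈1 : ℝ.fromℕ 3 ℝ.* ⅓ ℝ.≈ ℝ.1#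
      3*⅓≈1 = *-inverse (ℝ.fromℕ 3) (inj₂ (ℝ.fromℕ-positive 3))

      ⅔π : ℝ
      ⅔π = (ℝ.fromℕ 2 ℝ.* π) ℝ./ 3

      -- These follow the unfolding of `ℝ.fromℕ 2` and `ℝ.fromℕ 3`, trailing zero included, so that
      -- the solver's statement matches the goal.
      two three : ∀ {n} → Rℝ.Polynomial n
      two   = con 1ℤ :+ (con 1ℤ :+ con 0ℤ)
      three = con 1ℤ :+ two

      ⅔π+⅔π+⅔π≈π+π : ⅔π ℝ.+ ⅔π ℝ.+ ⅔π ℝ.≈ π ℝ.+ π
      ⅔π+⅔π+⅔π≈π+π = Rℝ.trans
        (Rℝ.solve 2 (λ p t → two :* p :* t :+ two :* p :* t :+ two :* p :* t := (p :+ p) :* (three :* t)) Rℝ.refl π ⅓)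
        (Rℝ.trans (Rℝ.*-congˡ 3*⅓≈1) (Rℝ.*-identityʳ _))

      positive-⅔π : Positive ⅔π
      positive-⅔π = ℝ.fromℕ-positive 2 ⊛ IsPi.positive isPi ⊛ positive-inverse (ℝ.fromℕ-positive 3)

      ⅔π<π : ⅔π ℝ.< π
      ⅔π<π = positive⇒< (positive-resp
        (Rℝ.trans (Rℝ.solve 2 (λ p t → p :* t := p :* (three :* t) :- two :* p :* t) Rℝ.refl π ⅓)
          (Rℝ.+-congʳ (Rℝ.trans (Rℝ.*-congˡ 3*⅓≈1) (Rℝ.*-identityʳ _))))
        (IsPi.positive isPi ⊛ positive-inverse (ℝ.fromℕ-positive 3)))

    module _ {ω : ℂ} (h : HasExp (imaginary ⅔π) ω) where

      ω-unit : ω * conj ω ≈ 1#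
      ω-unit = hasExp-imaginary⇒unit h

      ω³≈1 : ω * ω * ω ≈ 1#
      ω³≈1 = exp-2πi≈1 (hasExp-resp
        (Rℝ.solve 0 (con 0ℤ :+ con 0ℤ :+ con 0ℤ := con 0ℤ :+ con 0ℤ) Rℝ.refl , ⅔π+⅔π+⅔π≈π+π) Rℂ.refl (hasExp-+ (hasExp-+ h h) h))

      conj-ω≈ω² : conj ω ≈ ω * ω
      conj-ω≈ω² = begin
        conj ω                 ≈⟨ Rℂ.*-identityʳ (conj ω) ⟨
        conj ω * 1#            ≈⟨ Rℂ.*-congˡ {conj ω} ω³≈1 ⟨
        conj ω * (ω * ω * ω)   ≈⟨ Rℂ.*-comm (conj ω) (ω * ω * ω) ⟩
        ω * ω * ω * conj ω     ≈⟨ Rℂ.*-assoc (ω * ω) ω (conj ω) ⟩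
        ω * ω * (ω * conj ω)   ≈⟨ Rℂ.*-congˡ {ω * ω} ω-unit ⟩
        ω * ω * 1#             ≈⟨ Rℂ.*-identityʳ (ω * ω) ⟩
        ω * ω                  ∎
        where open SetoidReasoning Rℂ.setoid

      -- Minimality of π gives a mere negation and no apartness, so `im ω` cannot be inverted. It
      -- suffices because equality to 0 follows from refuting both signs: the other factor, 1 + 2 re
      -- ω, is assumed positive or negative and is then the one that gets inverted.
      im-ω≉0 : ¬ im ω ℝ.≈ ℝ.0#
      im-ω≉0 im-ω≈0 = IsPi.smallest isPi ⅔π positive-⅔π ⅔π<π (ω , h , im-ω≈0)

      -- The imaginary part of conj ω ≈ ω² is im ω (1 + 2 re ω) ≈ 0.
      1+2re-ω≈0 : ℝ.1# ℝ.+ (re ω ℝ.+ re ω) ℝ.≈ ℝ.0#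
      1+2re-ω≈0 = ¬positive⇒≈0
        (λ t>0 → im-ω≉0 (cancel t>0 (Rℝ.trans (Rℝ.*-comm _ _) im*t≈0)))
        (λ -t>0 → im-ω≉0 (cancel -t>0 (Rℝ.trans
          (Rℝ.solve 2 (λ x y → (Rℝ.:- y) :* x := Rℝ.:- (x :* y)) Rℝ.refl (im ω) t)
          (Rℝ.trans (Rℝ.-‿cong im*t≈0) (Rℝ.solve 0 (Rℝ.:- con 0ℤ := con 0ℤ) Rℝ.refl)))))
        where
        t = ℝ.1# ℝ.+ (re ω ℝ.+ re ω)
        im*t≈0 : im ω ℝ.* t ℝ.≈ ℝ.0#
        im*t≈0 = Rℝ.trans
          (Rℝ.solve 2 (λ x y → y :* (con 1ℤ :+ (x :+ x)) := (x :* y :+ y :* x) :- (Rℝ.:- y)) Rℝ.refl (re ω) (im ω))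
          (Rℝ.trans (Rℝ.+-congʳ (Rℝ.sym (proj₂ conj-ω≈ω²))) (Rℝ.-‿inverseʳ _))
        cancel : ∀ {k x} → Positive k → k ℝ.* x ℝ.≈ ℝ.0# → x ℝ.≈ ℝ.0#
        cancel {k} {x} k>0 kx≈0 = Rℝ.trans (Rℝ.sym (Rℝ.*-identityˡ x))
          (Rℝ.trans (Rℝ.*-congʳ (Rℝ.sym (*-inverse k (inj₂ k>0))))
            (Rℝ.trans (Rℝ.solve 3 (λ k l x → k :* l :* x := l :* (k :* x)) Rℝ.refl k (ℝ.inverse k (inj₂ k>0)) x)
              (Rℝ.trans (Rℝ.*-congˡ kx≈0) (Rℝ.zeroʳ _))))

      1+ω+ω²≈0 : 1# + ω + ω * ω ≈ 0#
      1+ω+ω²≈0 = Rℂ.trans (Rℂ.+-congˡ {1# + ω} (Rℂ.sym conj-ω≈ω²))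
        ( Rℝ.trans (Rℝ.+-assoc _ _ _) 1+2re-ω≈0
        , Rℝ.solve 1 (λ y → con 0ℤ :+ y :- y := con 0ℤ) Rℝ.refl (im ω))

-- The array √6 `Φ₂₇` over the Eisenstein integers, by computation

module Exact where

  open E

  H : Fin 6 → Fin 6 → ℤ[ω]
  H = (1# ∷ 1#    ∷ 1#    ∷ 1#    ∷ 1#    ∷ 1#      ∷ [])
    ∷ (1# ∷ ω     ∷ ω * ω ∷ 1#    ∷ ω     ∷ ω * ω   ∷ [])
    ∷ (1# ∷ ω * ω ∷ ω     ∷ ω     ∷ 1#    ∷ ω * ω   ∷ [])
    ∷ (1# ∷ 1#    ∷ 1#    ∷ - 1#  ∷ - 1#  ∷ - 1#    ∷ [])
    ∷ (1# ∷ ω     ∷ ω * ω ∷ - 1#  ∷ - ω   ∷ - (ω * ω) ∷ [])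
    ∷ (1# ∷ ω * ω ∷ ω     ∷ - ω   ∷ - 1#  ∷ - (ω * ω) ∷ [])
    ∷ []

  δ : ∀ {n} → Fin n → Fin n → ℤ[ω]
  δ i j = if does (i ≟ j) then 1# else 0#

  K : Fin 6 → Fin 6 → ℤ[ω]
  K i j = sum λ k → δ (transpose zero (suc zero) ⟨$⟩ʳ i) k * H k j

  Φ : Fin 6 → Fin 6 → Fin 6 → ℤ[ω]
  Φ i j m = H m i * K m j

  6δ : Fin 6 → Fin 6 → ℤ[ω]
  6δ i j = (+ 6 +ω 0ℤ) * δ i j

  Orthogonal : (Fin 6 → Fin 6 → ℤ[ω]) → Set
  Orthogonal v = ∀ i j → sum (λ m → conj (v i m) * v j m) ≡ 6δ i j

  -- With the vectors as columns of V, this is VV* = 6, the companion of V*V = 6 above.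
  Complete : (Fin 6 → Fin 6 → ℤ[ω]) → Set
  Complete v = ∀ m k → sum (λ j → v j m * conj (v j k)) ≡ 6δ m k

  -- Φ (3 + i) j = Φ i (3 + j) for i, j < 3, so the positions with i < 3 or j ≥ 3 suffice.
  position : Fin 27 → Fin 6 × Fin 6
  position k = [ (λ a → map (_↑ˡ 3) id (remQuot {3} 6 a)) , (λ b → map (3 ↑ʳ_) (3 ↑ʳ_) (remQuot {3} 3 b)) ]′ (splitAt 18 k)

  entry : Fin 6 × Fin 6 → Fin 6 → ℤ[ω]
  entry (i , j) = Φ i j

  -- The 2 × 2 minor in coordinates m and 0. Coordinate 0 can be kept fixed because all coordinates
  -- of the entries are roots of unity, hence nonzero.
  minor : Fin 6 × Fin 6 → Fin 6 × Fin 6 → Fin 6 → ℤ[ω]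
  minor p q m = entry p m * entry q zero + - (entry p zero * entry q m)

  -- Closed decidable statements, settled by evaluation. `abstract` keeps later type checking from
  -- running the decision procedures again.
  abstract
    rows-orthogonal : ∀ i → Orthogonal (λ j → Φ i j)
    rows-orthogonal = from-yes (all? λ i → all? λ j → all? λ k → sum (λ m → conj (Φ i j m) * Φ i k m) ≟ω 6δ j k)

    rows-complete : ∀ i → Complete (λ j → Φ i j)
    rows-complete = from-yes (all? λ i → all? λ m → all? λ k → sum (λ j → Φ i j m * conj (Φ i j k)) ≟ω 6δ m k)

    columns-orthogonal : ∀ j → Orthogonal (λ i → Φ i j)
    columns-orthogonal = from-yes (all? λ i → all? λ j → all? λ k → sum (λ m → conj (Φ j i m) * Φ k i m) ≟ω 6δ j k)

    columns-complete : ∀ j → Complete (λ i → Φ i j)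
    columns-complete = from-yes (all? λ i → all? λ m → all? λ k → sum (λ j → Φ j i m * conj (Φ j i k)) ≟ω 6δ m k)

    position-covers : ∀ i j → ∃[ x ] (∀ m → entry (position x) m ≡ Φ i j m)
    position-covers = from-yes (all? λ i → all? λ j → any? λ x → all? λ m → entry (position x) m ≟ω Φ i j m)

    -- The norm is tested in place of the minor because it is an integer, and a nonzero integer
    -- stays nonzero in ℂ.
    position-separated : ∀ x y → x ≡ y ⊎ ∃[ m ] norm (minor (position x) (position y) m) ≢ 0ℤ
    position-separated = from-yes (all? λ x → all? λ y → (x ≟ y) ⊎-dec any? λ m → ¬? (norm (minor (position x) (position y) m) ℤ.≟ 0ℤ))

-- Finite sums against the Kronecker delta, and proportional vectors

module KroneckerSums {c ℓ} (CR : CommutativeRing c ℓ) where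

  open CommutativeRing CR hiding (zero)
  open IntegerCoefficients CR using (solve; _:=_; _:*_)
  open Sum semiring using (sum; sum-cong-≋; sum-replicate-zero; ∑-comm; *-distribˡ-sum)
  open SetoidReasoning setoid

  sum-*-δ : ∀ {n} (x : Fin n → Carrier) j → sum (λ k → x k * (if does (j ≟ k) then 1# else 0#)) ≈ x j
  sum-*-δ {suc n} x zero = trans
    (+-cong (*-identityʳ (x zero)) (trans (sum-cong-≋ {n} (λ k → zeroʳ (x (suc k)))) (sum-replicate-zero n)))
    (+-identityʳ (x zero))
  sum-*-δ {suc n} x (suc j) = trans (+-cong (zeroʳ (x zero)) (sum-*-δ (x ∘ suc) j)) (+-identityˡ _)

  sum-*-0 : ∀ {n} (x y : Fin n → Carrier) → (∀ k → y k ≈ 0#) → sum (λ k → x k * y k) ≈ 0#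
  sum-*-0 {n} x y y≈0 = trans (sum-cong-≋ {n} (λ k → trans (*-congˡ (y≈0 k)) (zeroʳ (x k)))) (sum-replicate-zero n)

  sum-exchange : ∀ {k n} (x : Fin k → Carrier) (y : Fin n → Carrier) (M : Fin k → Fin n → Carrier) →
    sum (λ i → x i * sum (λ m → y m * M i m)) ≈ sum (λ m → y m * sum (λ i → x i * M i m))
  sum-exchange {k} {n} x y M = begin
    sum (λ i → x i * sum (λ m → y m * M i m))
      ≈⟨ sum-cong-≋ {k} (λ i → *-distribˡ-sum {n} (x i) (λ m → y m * M i m)) ⟩
    sum (λ i → sum (λ m → x i * (y m * M i m)))
      ≈⟨ ∑-comm {k} {n} (λ i m → x i * (y m * M i m)) ⟩
    sum (λ m → sum (λ i → x i * (y m * M i m)))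
      ≈⟨ sum-cong-≋ {n} (λ m → sum-cong-≋ {k} (λ i → solve 3 (λ x y z → x :* (y :* z) := y :* (x :* z)) refl (x i) (y m) (M i m))) ⟩
    sum (λ m → sum (λ i → y m * (x i * M i m)))
      ≈⟨ sum-cong-≋ {n} (λ m → *-distribˡ-sum {k} (y m) (λ i → x i * M i m)) ⟨
    sum (λ m → y m * sum (λ i → x i * M i m)) ∎

  [wx][yz]≈[wy][xz] : ∀ w x y z → (w * x) * (y * z) ≈ (w * y) * (x * z)
  [wx][yz]≈[wy][xz] = solve 4 (λ w x y z → (w :* x) :* (y :* z) := (w :* y) :* (x :* z)) refl

  -- Cross multiplication eliminates the factor `w`: phase equivalence becomes the vanishing of
  -- minors, whatever the phase.
  cross-proportional : ∀ w u₁ u₂ v₁ v₂ → u₁ ≈ w * v₁ → u₂ ≈ w * v₂ → u₁ * v₂ ≈ u₂ * v₁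
  cross-proportional w u₁ u₂ v₁ v₂ p q = trans (*-congʳ p)
    (trans (solve 3 (λ w x y → w :* x :* y := w :* y :* x) refl w v₁ v₂) (*-congʳ (sym q)))

-- Transfer from the Eisenstein integers to ℂ, and the two claims

module SchurArray {c ℓ₁ ℓ₂} (R : RealNumbers c ℓ₁ ℓ₂) where

  open Complex R
  open RealProperties R
  open ComplexRing R
  open Exponential R
  open KroneckerSums ℂ-commutativeRing
  open IntegerCoefficients ℂ-commutativeRing using (fromℤ)
  open SetoidReasoning Rℂ.setoid

  -- The hypotheses are V*V = 1 and VV* = 1 for the matrix V with columns `v`. The first recovers
  -- the coefficients of a combination, whence independence; the second expands x with the
  -- coefficients ⟨ v j , x ⟩. Having both replaces a dimension argument.
  orthonormalBasis : ∀ {n} (v : Fin n → ℂ^ n) →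
    (∀ i j → ⟨ v i , v j ⟩ ≈ δ i j) → (∀ m k → sum (λ j → v j m * conj (v j k)) ≈ δ m k) → IsOrthonormalBasis v
  orthonormalBasis {n} v orthonormal complete = record
    { orthonormal = orthonormal
    ; linearlyIndependent = λ a av≈0 j → begin
        a j                                                    ≈⟨ sum-*-δ a j ⟨
        sum (λ i → a i * δ j i)                                ≈⟨ Rℂ.sum-cong-≋ {n} (λ i → Rℂ.*-congˡ {a i} (orthonormal j i)) ⟨
        sum (λ i → a i * ⟨ v j , v i ⟩)                        ≈⟨ sum-exchange a (λ m → conj (v j m)) v ⟩
        sum (λ m → conj (v j m) * linearCombination a v m)     ≈⟨ sum-*-0 (λ m → conj (v j m)) (linearCombination a v) av≈0 ⟩
        0#                                                     ∎
    ; spanning = λ x → (λ j → ⟨ v j , x ⟩) , λ m → begin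
        sum (λ j → ⟨ v j , x ⟩ * v j m)                        ≈⟨ Rℂ.sum-cong-≋ {n} (λ j → Rℂ.*-comm ⟨ v j , x ⟩ (v j m)) ⟩
        sum (λ j → v j m * ⟨ v j , x ⟩)                        ≈⟨ Rℂ.sum-cong-≋ {n} (λ j → Rℂ.*-congˡ {v j m}
                                                                    (Rℂ.sum-cong-≋ {n} (λ k → Rℂ.*-comm (conj (v j k)) (x k)))) ⟩
        sum (λ j → v j m * sum (λ k → x k * conj (v j k)))     ≈⟨ sum-exchange (λ j → v j m) x (λ j k → conj (v j k)) ⟩
        sum (λ k → x k * sum (λ j → v j m * conj (v j k)))     ≈⟨ Rℂ.sum-cong-≋ {n} (λ k → Rℂ.*-congˡ {x k} (complete m k)) ⟩
        sum (λ k → x k * δ m k)                                ≈⟨ sum-*-δ x m ⟩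
        x m                                                    ∎
    }

  -- Bridges the optimised multiples of the solver and the plain ones of `ℝ.fromℕ`.
  fromℤ-real : ∀ n → fromℤ (+ n) ≈ real (ℝ.fromℕ n)
  fromℤ-real n = Rℂ.trans (Rℂ.sym (Rℂ.×ᵤ≈× n 1#)) (fromℕ-real n)

  conj-fromℤ : ∀ i → conj (fromℤ i) ≈ fromℤ i
  conj-fromℤ (+ n)    = Rℂ.trans (conj-cong (fromℤ-real n)) (Rℂ.trans (conj-real _) (Rℂ.sym (fromℤ-real n)))
  conj-fromℤ -[1+ n ] = Rℂ.trans (conj-neg (fromℤ (+ suc n))) (Rℂ.-‿cong (conj-fromℤ (+ suc n)))

  -- Characteristic 0 comes from the order: a positive integer has positive real part in ℂ.
  fromℤ≈0⇒≡0 : ∀ i → fromℤ i ≈ 0# → i ≡ 0ℤ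
  fromℤ≈0⇒≡0 (+ zero)  _  = ≡.refl
  fromℤ≈0⇒≡0 (+ suc n) eq = ⊥-elim (¬positive-0 (positive-resp eq′ (ℝ.fromℕ-positive (suc n))))
    where
    eq′ : ℝ.fromℕ (suc n) ℝ.≈ ℝ.0#
    eq′ = proj₁ (Rℂ.trans (Rℂ.sym (fromℤ-real (suc n))) eq)
  fromℤ≈0⇒≡0 -[1+ n ] eq with fromℤ≈0⇒≡0 (+ suc n) (begin
    fromℤ (+ suc n)            ≈⟨ Rℂ.+-identityʳ _ ⟨
    fromℤ (+ suc n) + 0#       ≈⟨ Rℂ.+-congˡ {fromℤ (+ suc n)} eq ⟨
    fromℤ (+ suc n) + - fromℤ (+ suc n) ≈⟨ Rℂ.-‿inverseʳ (fromℤ (+ suc n)) ⟩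
    0# ∎)
  ... | ()

  module _ (ω : ℂ) (1+ω+ω²≈0 : 1# + ω + ω * ω ≈ 0#) (conj-ω≈ω² : conj ω ≈ ω * ω) where

    open Evaluation.At ℂ-commutativeRing ω 1+ω+ω²≈0

    conj-⟦⟧ : ∀ x → conj ⟦ x ⟧ω ≈ ⟦ E.conj x ⟧ω
    conj-⟦⟧ (a +ω b) = begin
      conj (fromℤ a + fromℤ b * ω)         ≈⟨ conj-+ (fromℤ a) (fromℤ b * ω) ⟩
      conj (fromℤ a) + conj (fromℤ b * ω)  ≈⟨ Rℂ.+-cong (conj-fromℤ a) (Rℂ.trans (conj-* (fromℤ b) ω) (Rℂ.*-cong (conj-fromℤ b) conj-ω≈ω²)) ⟩
      fromℤ a + fromℤ b * (ω * ω)          ≈⟨ ⟦⟧-conj a b ⟨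
      ⟦ E.conj (a +ω b) ⟧ω                 ∎

    -- The norm evaluates to a multiple of ⟦ x ⟧ω, and an integer that vanishes in ℂ is 0.
    ⟦⟧≈0⇒norm≡0 : ∀ x → ⟦ x ⟧ω ≈ 0# → E.norm x ≡ 0ℤ
    ⟦⟧≈0⇒norm≡0 x eq = fromℤ≈0⇒≡0 (E.norm x)
      (Rℂ.trans (fromℤ-norm x) (Rℂ.trans (Rℂ.*-congʳ {⟦ E.conj x ⟧ω} eq) (Rℂ.zeroˡ ⟦ E.conj x ⟧ω)))

    -- A record, so that z and x can be inferred from it.
    infix 4 _≈⟦_⟧
    record _≈⟦_⟧ (z : ℂ) (x : ℤ[ω]) : Set ℓ₁ where
      constructor ⌈_⌉
      field value : z ≈ ⟦ x ⟧ω
    open _≈⟦_⟧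

    private
      infixr 5 _∷≈_
      _∷≈_ : ∀ {n x a} {v : Vector ℂ n} {w : Vector ℤ[ω] n} →
        x ≈⟦ a ⟧ → (∀ i → v i ≈⟦ w i ⟧) → ∀ i → (x ∷ v) i ≈⟦ (a ∷ w) i ⟧
      (p ∷≈ q) zero    = p
      (p ∷≈ q) (suc i) = q i

      one : 1# ≈⟦ E.1# ⟧
      one = ⌈ Rℂ.sym ⟦1⟧ ⌉

      root : ω ≈⟦ E.ω ⟧
      root = ⌈ Rℂ.sym ⟦ω⟧ ⌉

      root² : ω * ω ≈⟦ E.ω E.* E.ω ⟧
      root² = ⌈ Rℂ.trans (Rℂ.*-cong (value root) (value root)) (Rℂ.sym (⟦⟧-* E.ω E.ω)) ⌉

      neg : ∀ {x a} → x ≈⟦ a ⟧ → - x ≈⟦ E.- a ⟧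
      neg {a = a} p = ⌈ Rℂ.trans (Rℂ.-‿cong (value p)) (Rℂ.sym (⟦⟧-neg a)) ⌉

    H≈⟦H⟧ : ∀ m i → H ω m i ≈⟦ Exact.H m i ⟧
    H≈⟦H⟧ zero = one ∷≈ one ∷≈ one ∷≈ one ∷≈ one ∷≈ one ∷≈ λ ()
    H≈⟦H⟧ (suc zero) = one ∷≈ root ∷≈ root² ∷≈ one ∷≈ root ∷≈ root² ∷≈ λ ()
    H≈⟦H⟧ (suc (suc zero)) = one ∷≈ root² ∷≈ root ∷≈ root ∷≈ one ∷≈ root² ∷≈ λ ()
    H≈⟦H⟧ (suc (suc (suc zero))) = one ∷≈ one ∷≈ one ∷≈ neg one ∷≈ neg one ∷≈ neg one ∷≈ λ ()
    H≈⟦H⟧ (suc (suc (suc (suc zero)))) = one ∷≈ root ∷≈ root² ∷≈ neg one ∷≈ neg root ∷≈ neg root² ∷≈ λ ()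
    H≈⟦H⟧ (suc (suc (suc (suc (suc zero))))) = one ∷≈ root² ∷≈ root ∷≈ neg root ∷≈ neg one ∷≈ neg root² ∷≈ λ ()

    δ≈⟦δ⟧ : ∀ {n} (i j : Fin n) → δ i j ≈ ⟦ Exact.δ i j ⟧ω
    δ≈⟦δ⟧ i j with does (i ≟ j)
    ... | true  = Rℂ.sym ⟦1⟧
    ... | false = Rℂ.sym ⟦0⟧

    K≈⟦K⟧ : ∀ m j → K ω m j ≈ ⟦ Exact.K m j ⟧ω
    K≈⟦K⟧ m j = Rℂ.trans
      (Rℂ.sum-cong-≋ {6} (λ k → Rℂ.trans (Rℂ.*-cong (δ≈⟦δ⟧ (σ m) k) (value (H≈⟦H⟧ k j))) (Rℂ.sym (⟦⟧-* (Exact.δ (σ m) k) (Exact.H k j)))))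
      (Rℂ.sym (⟦⟧-sum (λ k → Exact.δ (σ m) k E.* Exact.H k j)))
      where
      σ : Fin 6 → Fin 6
      σ i = transpose zero (suc zero) ⟨$⟩ʳ i

    module _ (√6 : ℝ) (0<√6 : ℝ.0# ℝ.< √6) (√6*√6≈6 : √6 ℝ.* √6 ℝ.≈ ℝ.fromℕ 6) where

      private
        1/√6 : ℝ
        1/√6 = ℝ.inverse √6 (inj₂ 0<√6)

        r : ℂ
        r = real 1/√6

      1/√6*1/√6*6≈1 : (1/√6 ℝ.* 1/√6) ℝ.* ℝ.fromℕ 6 ℝ.≈ ℝ.1#
      1/√6*1/√6*6≈1 = Rℝ.trans (Rℝ.*-congˡ (Rℝ.sym √6*√6≈6)) (Rℝ.trans
        (Rℝ.solve 2 (λ x y → (y Rℝ.:* y) Rℝ.:* (x Rℝ.:* x) Rℝ.:= (x Rℝ.:* y) Rℝ.:* (x Rℝ.:* y)) Rℝ.refl √6 1/√6)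
        (Rℝ.trans (Rℝ.*-cong √6*1/√6≈1 √6*1/√6≈1) (Rℝ.*-identityʳ ℝ.1#)))
        where
        √6*1/√6≈1 : √6 ℝ.* 1/√6 ℝ.≈ ℝ.1#
        √6*1/√6≈1 = *-inverse √6 (inj₂ 0<√6)

      6ω : ℤ[ω]
      6ω = + 6 +ω 0ℤ

      r*r*⟦6⟧≈1 : (r * r) * ⟦ 6ω ⟧ω ≈ 1#
      r*r*⟦6⟧≈1 = begin
        (r * r) * (fromℤ (+ 6) + fromℤ 0ℤ * ω)
          ≈⟨ Rℂ.*-cong (Rℂ.sym (real-* 1/√6 1/√6)) (Rℂ.trans (Rℂ.+-cong (fromℤ-real 6) (Rℂ.zeroˡ ω)) (Rℂ.+-identityʳ (real (ℝ.fromℕ 6)))) ⟩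
        real (1/√6 ℝ.* 1/√6) * real (ℝ.fromℕ 6)
          ≈⟨ real-* (1/√6 ℝ.* 1/√6) (ℝ.fromℕ 6) ⟨
        real ((1/√6 ℝ.* 1/√6) ℝ.* ℝ.fromℕ 6)
          ≈⟨ 1/√6*1/√6*6≈1 , Rℝ.refl ⟩
        1# ∎

      r*r*⟦⟧≈0⇒⟦⟧≈0 : ∀ x → (r * r) * ⟦ x ⟧ω ≈ 0# → ⟦ x ⟧ω ≈ 0#
      r*r*⟦⟧≈0⇒⟦⟧≈0 x eq = begin
        ⟦ x ⟧ω                          ≈⟨ Rℂ.*-identityˡ ⟦ x ⟧ω ⟨
        1# * ⟦ x ⟧ω                     ≈⟨ Rℂ.*-congʳ {⟦ x ⟧ω} r*r*⟦6⟧≈1 ⟨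
        (r * r) * ⟦ 6ω ⟧ω * ⟦ x ⟧ω      ≈⟨ Rℂ.*-congʳ {⟦ x ⟧ω} (Rℂ.*-comm (r * r) ⟦ 6ω ⟧ω) ⟩
        ⟦ 6ω ⟧ω * (r * r) * ⟦ x ⟧ω      ≈⟨ Rℂ.*-assoc ⟦ 6ω ⟧ω (r * r) ⟦ x ⟧ω ⟩
        ⟦ 6ω ⟧ω * ((r * r) * ⟦ x ⟧ω)    ≈⟨ Rℂ.*-congˡ {⟦ 6ω ⟧ω} eq ⟩
        ⟦ 6ω ⟧ω * 0#                    ≈⟨ Rℂ.zeroʳ ⟦ 6ω ⟧ω ⟩
        0# ∎

      -- The factor r = 1/√6 stays outside the evaluation, so that inner products and minors acquire
      -- r² = 1/6 while the remaining arithmetic takes place in ℤ[ω]. Again a record for the sake of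
      -- inference.
      record Scaled (z : ℂ) (x : ℤ[ω]) : Set ℓ₁ where
        constructor ⌈_⌉
        field value : z ≈ r * ⟦ x ⟧ω
      open Scaled

      scaled-* : ∀ {z w x y} → Scaled z x → Scaled w y → z * w ≈ (r * r) * ⟦ x E.* y ⟧ω
      scaled-* {x = x} {y} p q = Rℂ.trans (Rℂ.*-cong (value p) (value q))
        (Rℂ.trans ([wx][yz]≈[wy][xz] r ⟦ x ⟧ω r ⟦ y ⟧ω) (Rℂ.*-congˡ {r * r} (Rℂ.sym (⟦⟧-* x y))))

      scaled-conj : ∀ {z x} → Scaled z x → Scaled (conj z) (E.conj x)
      scaled-conj {x = x} p = ⌈ Rℂ.trans (conj-cong (value p)) (Rℂ.trans (conj-* r ⟦ x ⟧ω) (Rℂ.*-cong (conj-real 1/√6) (conj-⟦⟧ x))) ⌉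

      scaled-sum : ∀ {n} (f : Fin n → ℂ) (g : Fin n → ℤ[ω]) → (∀ i → f i ≈ (r * r) * ⟦ g i ⟧ω) → sum f ≈ (r * r) * ⟦ E.sum g ⟧ω
      scaled-sum {n} f g f≈g = begin
        sum f                              ≈⟨ Rℂ.sum-cong-≋ {n} f≈g ⟩
        sum (λ i → (r * r) * ⟦ g i ⟧ω)     ≈⟨ Rℂ.*-distribˡ-sum {n} (r * r) (λ i → ⟦ g i ⟧ω) ⟨
        (r * r) * sum (λ i → ⟦ g i ⟧ω)     ≈⟨ Rℂ.*-congˡ {r * r} (⟦⟧-sum g) ⟨
        (r * r) * ⟦ E.sum g ⟧ω ∎

      scaled-6δ : ∀ i j → (r * r) * ⟦ Exact.6δ i j ⟧ω ≈ δ i j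
      scaled-6δ i j = begin
        (r * r) * ⟦ 6ω E.* Exact.δ i j ⟧ω          ≈⟨ Rℂ.*-congˡ {r * r} (⟦⟧-* 6ω (Exact.δ i j)) ⟩
        (r * r) * (⟦ 6ω ⟧ω * ⟦ Exact.δ i j ⟧ω)     ≈⟨ Rℂ.*-assoc (r * r) ⟦ 6ω ⟧ω ⟦ Exact.δ i j ⟧ω ⟨
        (r * r) * ⟦ 6ω ⟧ω * ⟦ Exact.δ i j ⟧ω       ≈⟨ Rℂ.*-cong r*r*⟦6⟧≈1 (Rℂ.sym (δ≈⟦δ⟧ i j)) ⟩
        1# * δ i j                                 ≈⟨ Rℂ.*-identityˡ (δ i j) ⟩
        δ i j ∎

      scaled-basis : ∀ {v : Fin 6 → ℂ^ 6} {w} → (∀ i m → Scaled (v i m) (w i m)) → Exact.Orthogonal w → Exact.Complete w → IsOrthonormalBasis v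
      scaled-basis {v} {w} v≈w orthogonal complete = orthonormalBasis v
        (λ i j → Rℂ.trans (scaled-sum (λ m → conj (v i m) * v j m) (λ m → E.conj (w i m) E.* w j m)
            (λ m → scaled-* (scaled-conj (v≈w i m)) (v≈w j m)))
          (Rℂ.trans (Rℂ.*-congˡ {r * r} (Rℂ.reflexive (≡.cong ⟦_⟧ω (orthogonal i j)))) (scaled-6δ i j)))
        (λ m k → Rℂ.trans (scaled-sum (λ j → v j m * conj (v j k)) (λ j → w j m E.* E.conj (w j k))
            (λ j → scaled-* (v≈w j m) (scaled-conj (v≈w j k))))
          (Rℂ.trans (Rℂ.*-congˡ {r * r} (Rℂ.reflexive (≡.cong ⟦_⟧ω (complete m k)))) (scaled-6δ m k)))

      Φ : Array 6
      Φ = Φ₂₇ ω √6 0<√6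

      Φ-scaled : ∀ i j m → Scaled (Φ i j m) (Exact.Φ i j m)
      Φ-scaled i j m = ⌈ Rℂ.*-congˡ {r} (Rℂ.trans (Rℂ.*-cong (value (H≈⟦H⟧ m i)) (K≈⟦K⟧ m j)) (Rℂ.sym (⟦⟧-* (Exact.H m i) (Exact.K m j)))) ⌉

      row-basis : ∀ i → IsOrthonormalBasis (λ j → Φ i j)
      row-basis i = scaled-basis (Φ-scaled i) (Exact.rows-orthogonal i) (Exact.rows-complete i)

      column-basis : ∀ j → IsOrthonormalBasis (λ i → Φ i j)
      column-basis j = scaled-basis (λ i → Φ-scaled i j) (Exact.columns-orthogonal j) (Exact.columns-complete j)

      δ-refl : ∀ {n} (i : Fin n) → δ i i ≈ 1#
      δ-refl i = Rℂ.reflexive (≡.cong (λ b → if b then 1# else 0#) (dec-true (i ≟ i) ≡.refl))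

      isQuantumLatinSquare : IsQuantumLatinSquare Φ
      isQuantumLatinSquare = record
        { unit    = λ i j → Rℂ.trans (IsOrthonormalBasis.orthonormal (row-basis i) j j) (δ-refl j)
        ; rows    = row-basis
        ; columns = column-basis
        }

      entry : Fin 6 × Fin 6 → ℂ^ 6
      entry (i , j) = Φ i j

      entry-scaled : ∀ p m → Scaled (entry p m) (Exact.entry p m)
      entry-scaled (i , j) = Φ-scaled i j

      scaled-minor : ∀ {z₁ z₂ z₃ z₄ x₁ x₂ x₃ x₄} → Scaled z₁ x₁ → Scaled z₂ x₂ → Scaled z₃ x₃ → Scaled z₄ x₄ →
        (r * r) * ⟦ x₁ E.* x₂ E.+ E.- (x₃ E.* x₄) ⟧ω ≈ z₁ * z₂ + - (z₃ * z₄)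
      scaled-minor {z₁} {z₂} {z₃} {z₄} {x₁} {x₂} {x₃} {x₄} p₁ p₂ p₃ p₄ = begin
        (r * r) * ⟦ X E.+ E.- Y ⟧ω
          ≈⟨ Rℂ.*-congˡ {r * r} (Rℂ.trans (⟦⟧-+ X (E.- Y)) (Rℂ.+-congˡ {⟦ X ⟧ω} (⟦⟧-neg Y))) ⟩
        (r * r) * (⟦ X ⟧ω + - ⟦ Y ⟧ω)
          ≈⟨ Rℂ.distribˡ (r * r) ⟦ X ⟧ω (- ⟦ Y ⟧ω) ⟩
        (r * r) * ⟦ X ⟧ω + (r * r) * - ⟦ Y ⟧ω
          ≈⟨ Rℂ.+-cong (scaled-* p₁ p₂) (Rℂ.trans (Rℂ.-‿cong (scaled-* p₃ p₄)) (Rℂ.-‿distribʳ-* (r * r) ⟦ Y ⟧ω)) ⟨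
        z₁ * z₂ + - (z₃ * z₄) ∎
        where
        X = x₁ E.* x₂
        Y = x₃ E.* x₄

      proportional⇒minor≈0 : ∀ {n} {u v : ℂ^ n} {x y : Fin n → ℤ[ω]} →
        (∀ m → Scaled (u m) (x m)) → (∀ m → Scaled (v m) (y m)) →
        ∀ w → u ≋ w · v → ∀ k m → ⟦ x k E.* y m E.+ E.- (x m E.* y k) ⟧ω ≈ 0#
      proportional⇒minor≈0 {u = u} {v} {x} {y} u≈x v≈y w u≈wv k m =
        r*r*⟦⟧≈0⇒⟦⟧≈0 (x k E.* y m E.+ E.- (x m E.* y k)) (begin
          (r * r) * ⟦ x k E.* y m E.+ E.- (x m E.* y k) ⟧ω
            ≈⟨ scaled-minor (u≈x k) (v≈y m) (u≈x m) (v≈y k) ⟩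
          u k * v m + - (u m * v k)
            ≈⟨ Rℂ.+-congʳ {x = - (u m * v k)} (cross-proportional w (u k) (u m) (v k) (v m) (u≈wv k) (u≈wv m)) ⟩
          u m * v k + - (u m * v k)
            ≈⟨ Rℂ.-‿inverseʳ (u m * v k) ⟩
          0# ∎)

      ∼⇒minor≈0 : ∀ p q → entry p ∼ entry q → ∀ m → ⟦ Exact.minor p q m ⟧ω ≈ 0#
      ∼⇒minor≈0 p q (_ , w , _ , u≈wv) m =
        proportional⇒minor≈0 {u = entry p} {entry q} {Exact.entry p} {Exact.entry q} (entry-scaled p) (entry-scaled q) w u≈wv m zero

      exact-≡⇒∼ : ∀ p q → (∀ m → Exact.entry p m ≡ Exact.entry q m) → entry p ∼ entry q
      exact-≡⇒∼ p q eq = ℝ.0# , 1# , hasExp-0 , λ m → begin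
        entry p m                    ≈⟨ value (entry-scaled p m) ⟩
        r * ⟦ Exact.entry p m ⟧ω     ≈⟨ Rℂ.*-congˡ {r} (Rℂ.reflexive (≡.cong ⟦_⟧ω (eq m))) ⟩
        r * ⟦ Exact.entry q m ⟧ω     ≈⟨ value (entry-scaled q m) ⟨
        entry q m                    ≈⟨ Rℂ.*-identityˡ (entry q m) ⟨
        1# * entry q m               ∎

      position-injective : ∀ x y → entry (Exact.position x) ∼ entry (Exact.position y) → x ≡ y
      position-injective x y eq =
        [ id , (λ (m , norm≢0) → ⊥-elim (norm≢0 (⟦⟧≈0⇒norm≡0 (Exact.minor p q m) (∼⇒minor≈0 p q eq m)))) ]′
          (Exact.position-separated x y)
        where
        p = Exact.position x
        q = Exact.position y

      position-surjective : ∀ p → ∃[ x ] entry (Exact.position x) ∼ entry p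
      position-surjective p = proj₁ covers , exact-≡⇒∼ (Exact.position (proj₁ covers)) p (proj₂ covers)
        where covers = Exact.position-covers (proj₁ p) (proj₂ p)

      hasCardinality : HasCardinality Φ 27
      hasCardinality = Exact.position
        , (λ {x} {y} → position-injective x y)
        , (λ p → proj₁ (position-surjective p) , λ { ≡.refl → proj₂ (position-surjective p) })

theorem5 : ∀ {c ℓ₁ ℓ₂} (R : RealNumbers c ℓ₁ ℓ₂) → let open Complex R in
    (π : ℝ) → IsPi π →
    (ω : ℂ) → HasExp (imaginary ((ℝ.fromℕ 2 ℝ.* π) ℝ./ 3)) ω →
    (√6 : ℝ) (0<√6 : ℝ.0# ℝ.< √6) → √6 ℝ.* √6 ℝ.≈ ℝ.fromℕ 6 →
    IsQuantumLatinSquare (Φ₂₇ ω √6 0<√6) × HasCardinality (Φ₂₇ ω √6 0<√6) 27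
theorem5 R π isPi ω h √6 0<√6 √6*√6≈6 =
  isQuantumLatinSquare ω 1+ω+ω² conj-ω √6 0<√6 √6*√6≈6 ,
  hasCardinality ω 1+ω+ω² conj-ω √6 0<√6 √6*√6≈6
  where
  open SchurArray R
  open CubeRoot R
  1+ω+ω² = 1+ω+ω²≈0 isPi h
  conj-ω = conj-ω≈ω² isPi h
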